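{- Let $G$ be a finite simple triangle-free graph with maximum degree $\Delta(G)\leq 4$. Then $$\alpha(G)+\frac{3}{2}\beta(G)\geq n(G),$$ with equality if and only if every connected component $C$ of $G$ is either a single vertex, or a cycle on $5$ vertices, or satisfies $n(C)=13$, $\alpha(C)=4$, and $\beta(C)=6$.
   Context: All graphs are simple, finite and undirected. $n(G)$ is the number of vertices of $G$, $\alpha(G)$ is the independence number (maximum size of a set of pairwise non-adjacent vertices), and $\beta(G)$ is the matching number (maximum number of pairwise disjoint edges). Triangle-free means $G$ contains no $K_3$ as a subgraph. -}

module Defs where

open import Data.Bool.Base using (true; false)
open import Data.Fin.Base using (Fin; zero; suc; toℕ)
open import Data.Fin.Properties using (_≟_; all?; any?; injective⇒≤)
open import Data.Fin.Subset using (Subset; _∈_; ∣_∣; ⊥)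
open import Data.Fin.Subset.Properties using (_∈?_; anySubset?; ∣p∣≤n; ∣⊥∣≡0; ∉⊥)
open import Data.Integer.Base using (+_)
open import Data.List.Base using (map; allFin)
open import Data.List.Extrema.Nat using (max)
open import Data.Nat.Base using (ℕ; zero; suc; _≤_; _%_; s≤s⁻¹)
open import Data.Nat.Properties using (≤∧≢⇒<)
import Data.Nat.Properties as ℕ
open import Data.Product.Base using (∃; Σ-syntax; _×_; _,_; proj₁; proj₂; uncurry)
open import Data.Rational.Base using (ℚ; _/_)
open import Data.Sum.Base using (_⊎_; swap)
open import Data.Vec.Base as Vec using (Vec; []; _∷_; lookup; tabulate)
open import Data.Vec.Relation.Unary.All as All using (All; []; _∷_)
open import Data.Vec.Relation.Unary.AllPairs as AllPairs using (AllPairs; []; allPairs?)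
import Data.Vec.Relation.Unary.AllPairs.Properties as AllPairs
import Data.Vec.Relation.Unary.Unique.Propositional.Properties as Unique
open import Function.Bundles using (_⇔_; _↔_; Inverse)
open import Level using (0ℓ)
open import Relation.Binary.Construct.Closure.ReflexiveTransitive using (Star)
open import Relation.Binary.Core using (Rel)
import Relation.Binary.Definitions as Binary
open import Relation.Binary.PropositionalEquality using (_≡_; _≢_; refl)
open import Relation.Nullary using (¬_; Dec; yes; no; does)
open import Relation.Nullary.Decidable using (map′; ¬?; _×-dec_; _⊎-dec_; _→-dec_; from-yes)
open import Relation.Unary using (Pred; Decidable)

private
  variable
    m n : ℕ

record Graph (n : ℕ) : Set₁ where
  infix 4 _~_ _~?_
  field
    _~_    : Rel (Fin n) 0ℓ
    _~?_   : Binary.Decidable _~_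
    ~-sym  : ∀ {u v} → u ~ v → v ~ u
    irrefl : ∀ {v} → ¬ v ~ v

order : Graph n → ℕ
order {n} _ = n

TriangleFree : Graph n → Set
TriangleFree G = ∀ {u v w} → u ~ v → v ~ w → ¬ w ~ u
  where open Graph G

neighbours : Graph n → Fin n → Subset n
neighbours G v = tabulate (λ w → does (v ~? w))
  where open Graph G

degree : Graph n → Fin n → ℕ
degree G v = ∣ neighbours G v ∣

-- Zero for the graph without vertices.
Δ : Graph n → ℕ
Δ {n} G = max 0 (map (degree G) (allFin n))

IsMaximum : Pred ℕ 0ℓ → Pred ℕ 0ℓ
IsMaximum P k = P k × (∀ {j} → P j → j ≤ k)

maximum : {P : Pred ℕ 0ℓ} → Decidable P → P 0 →
          ∀ b → (∀ {j} → P j → j ≤ b) → ∃ (IsMaximum P)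
maximum P? p₀ zero    bound = 0 , p₀ , bound
maximum P? p₀ (suc b) bound with P? (suc b)
... | yes p = suc b , p , bound
... | no ¬p = maximum P? p₀ b λ pj →
  s≤s⁻¹ (≤∧≢⇒< (bound pj) λ { refl → ¬p pj })

module _ (G : Graph n) where
  open Graph G

  Independent : Subset n → Set
  Independent S = ∀ u v → u ∈ S → v ∈ S → ¬ u ~ v

  HasIndependentSet : ℕ → Set
  HasIndependentSet k = ∃ λ S → Independent S × ∣ S ∣ ≡ k

  independent? : Decidable Independent
  independent? S = all? λ u → all? λ v →
    u ∈? S →-dec v ∈? S →-dec ¬? (u ~? v)

  independenceNumber : ∃ (IsMaximum HasIndependentSet)
  independenceNumber = maximum
    (λ k → anySubset? λ S → independent? S ×-dec ∣ S ∣ ℕ.≟ k)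
    (⊥ , (λ _ _ u∈⊥ _ _ → ∉⊥ u∈⊥) , ∣⊥∣≡0 n)
    n
    λ { (S , _ , refl) → ∣p∣≤n S }

  α : ℕ
  α = proj₁ independenceNumber

-- An edge uv is given by either of the pairs (u , v) and (v , u), so an
-- edge is never Disjoint from itself or its reversal and a Matching
-- lists k different edges.
Disjoint : Rel (Fin n × Fin n) 0ℓ
Disjoint (a , b) (c , d) = a ≢ c × a ≢ d × b ≢ c × b ≢ d

disjoint? : Binary.Decidable (Disjoint {n})
disjoint? (a , b) (c , d) =
  ¬? (a ≟ c) ×-dec ¬? (a ≟ d) ×-dec ¬? (b ≟ c) ×-dec ¬? (b ≟ d)

anyVec? : ∀ k {P : Pred (Vec (Fin n × Fin n) k) 0ℓ} → Decidable P → Dec (∃ P)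
anyVec? zero    P? = map′ ([] ,_) (λ { ([] , p) → p }) (P? [])
anyVec? (suc k) P? = map′
  (λ { (u , v , M , p) → (u , v) ∷ M , p })
  (λ { ((u , v) ∷ M , p) → u , v , M , p })
  (any? λ u → any? λ v → anyVec? k λ M → P? ((u , v) ∷ M))

module _ (G : Graph n) where
  open Graph G

  Matching : ∀ {k} → Vec (Fin n × Fin n) k → Set
  Matching M = All (uncurry _~_) M × AllPairs Disjoint M

  HasMatching : ℕ → Set
  HasMatching k = Σ[ M ∈ Vec (Fin n × Fin n) k ] Matching M

  matching-size : ∀ {k} → HasMatching k → k ≤ n
  matching-size (M , _ , disjoint) = injective⇒≤ {f = lookup (Vec.map proj₁ M)}
    λ {i} {j} → Unique.lookup-injective
      (AllPairs.map⁺ (AllPairs.map proj₁ disjoint)) i j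

  matchingNumber : ∃ (IsMaximum HasMatching)
  matchingNumber = maximum
    (λ k → anyVec? k λ M → All.all? (uncurry _~?_) M ×-dec allPairs? disjoint? M)
    ([] , [] , [])
    n
    matching-size

  β : ℕ
  β = proj₁ matchingNumber

elements : (S : Subset n) → Vec (Fin n) ∣ S ∣
elements []          = []
elements (true  ∷ S) = zero ∷ Vec.map suc (elements S)
elements (false ∷ S) = Vec.map suc (elements S)

-- The induced subgraph, with its vertices renumbered in increasing order.
_[_] : Graph n → (S : Subset n) → Graph ∣ S ∣
G [ S ] = record
  { _~_    = λ i j → lookup (elements S) i ~ lookup (elements S) j
  ; _~?_   = λ i j → lookup (elements S) i ~? lookup (elements S) j
  ; ~-sym  = ~-sym
  ; irrefl = irrefl
  }
  where open Graph G

IsComponent : Graph n → Subset n → Set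
IsComponent G C = ∃ λ v → ∀ w → w ∈ C ⇔ Star _~_ v w
  where open Graph G

infix 4 _≅_

_≅_ : Graph m → Graph n → Set
_≅_ {m} {n} G H = Σ[ f ∈ Fin m ↔ Fin n ]
  (∀ u v → Graph._~_ G u v ⇔ Graph._~_ H (Inverse.to f u) (Inverse.to f v))

C₅ : Graph 5
C₅ = record
  { _~_    = _~_
  ; _~?_   = _~?_
  ; ~-sym  = swap
  ; irrefl = λ {v} → from-yes (all? λ v → ¬? (v ~? v)) v
  }
  where
  _~_ : Rel (Fin 5) 0ℓ
  u ~ v = toℕ v ≡ suc (toℕ u) % 5 ⊎ toℕ u ≡ suc (toℕ v) % 5

  _~?_ : Binary.Decidable _~_
  u ~? v = toℕ v ℕ.≟ suc (toℕ u) % 5 ⊎-dec toℕ u ℕ.≟ suc (toℕ v) % 5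

fromℕ : ℕ → ℚ
fromℕ k = + k / 1

{-# OPTIONS --safe #-}
module Submission where

-- If some vertex v is covered by every maximum matching, then deleting v keeps
-- α from growing and lowers β, so 2α + 3β ≥ 2n follows, strictly, from the bound for G - v.
-- Otherwise, by Gallai's lemma, "no maximum matching misses both u and v" is an
-- equivalence relation; it contains adjacency, and both sides of the bound add up
-- over its classes. If there is a single class then n = 2β + 1, and the claim
-- becomes 4α ≥ n + 3. This follows from Shearer's bound α ≥ Σ f(deg v) for triangle-free
-- graphs, combined with deg v ≤ α (neighbourhoods are independent), and it is
-- an equality only for (n , α) = (1 , 1), (5 , 2), (13 , 4).

open import Defs
open import Data.Bool.Base using (Bool; true; false; if_then_else_; not; _∧_; _∨_)
open import Data.Bool.Properties using (∨-zeroʳ) renaming (_≟_ to _≟ᵇ_)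
open import Data.Fin.Base as Fin using (Fin; zero; suc; toℕ; punchOut)
open import Data.Fin.Patterns using (0F; 1F; 2F; 3F; 4F)
open import Data.Fin.Permutation using (↔⇒≡)
open import Data.Fin.Properties
  using (_≟_; any?; all?; suc-injective; injective⇒≤; punchOut-injective)
import Data.Fin.Subset as Subset
import Data.Integer.Base as ℤ
import Data.Integer.Properties as ℤ
open import Data.List.Extrema.Nat using (xs≤max)
open import Data.List.Membership.Propositional.Properties using (∈-map⁺; ∈-allFin)
import Data.List.Relation.Unary.All as ListAll
open import Data.Nat.Base
  using (ℕ; zero; suc; _+_; _*_; _%_; _⊓_; _≤_; _<_; z≤n; s≤s; s≤s⁻¹)
import Data.Nat.Properties as ℕ
open import Data.Nat.Tactic.RingSolver using (solve-∀)
open import Data.Product.Base using (∃; Σ-syntax; ∃-syntax; _×_; _,_; proj₁; proj₂)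
import Data.Rational.Base as ℚ
import Data.Rational.Properties as ℚ
open import Data.Rational.Unnormalised.Base as ℚᵘ using (mkℚᵘ) renaming (_≃_ to _≃ᵘ_)
import Data.Rational.Unnormalised.Properties as ℚᵘ
open import Data.Sum.Base using (_⊎_; inj₁; inj₂; [_,_]′)
open import Data.Vec.Base as Vec using (Vec; []; _∷_; lookup; tabulate)
open import Data.Vec.Properties using (lookup-map; lookup∘tabulate; lookup⇒[]=; []=⇒lookup)
open import Data.Vec.Relation.Unary.All as All using (All; []; _∷_)
open import Data.Vec.Relation.Unary.AllPairs using ([]; _∷_)
open import Data.Vec.Relation.Unary.Unique.Propositional using (Unique)
open import Data.Vec.Relation.Unary.Unique.Propositional.Properties using (lookup-injective)
open import Function.Base using (_∘_; case_of_)
open import Function.Bundles using (_⇔_; _↔_; Inverse; Equivalence; mk⇔; mk↔ₛ′)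
open import Relation.Binary.Construct.Closure.ReflexiveTransitive using (Star; ε; _◅_; _◅◅_)
open import Relation.Binary.PropositionalEquality
  using (_≡_; _≢_; refl; sym; trans; cong; cong₂; subst; subst₂; ≢-sym; module ≡-Reasoning)
open import Relation.Nullary using (¬_; Dec; yes; no; does)
open import Relation.Nullary.Decidable
  using (dec-true; dec-false; ¬?; _×-dec_; _⊎-dec_; _→-dec_; from-yes)
open import Relation.Nullary.Negation using (contradiction)

import Algebra.Properties.Semiring.Sum ℕ.+-*-semiring as Sum

-- The recursion deletes vertices and splits vertex sets, whereas `G [ S ]` renumbers its vertices.
-- Hence `G` stays fixed, intermediate claims speak of a Boolean predicate `P` on its vertices, and
-- `Presents` carries α and β between `P` and an actual graph. The exceptional pairs come from
-- rounding. In a single class the weighted bound gives n ≤ 850 α / `weight (α ⊓ 4)`, that is n ≤ 2,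
-- 5, 8, 13 for α = 1, 2, 3, 4. As n is odd, 2 and 8 sharpen to 1 and 7. The values 1, 5, 13 equal
-- 4α - 3, while 7 is below it; from α = 5 on, 254 n ≤ 850 α leaves room to spare. For the equality
-- statement, slack in one component is slack in the total, so in a tight graph every component is
-- tight. A tight component has no vertex covered by all its maximum matchings and, being connected,
-- is a single class. Conversely, upper bounds on α and β of the listed components are enough,
-- because the inequality itself supplies the other direction.

private
  variable
    m n : ℕ

-- Finite sums, Boolean subsets and their cardinalities.

opaque
  -- Sealed, so that later proofs see sums only through the laws of this block.
  ∑ : (Fin n → ℕ) → ℕ
  ∑ = Sum.sum

  ∑-cong : {f g : Fin n → ℕ} → (∀ i → f i ≡ g i) → ∑ f ≡ ∑ g
  ∑-cong = Sum.sum-cong-≗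

  ∑-+ : (f g : Fin n → ℕ) → ∑ (λ i → f i + g i) ≡ ∑ f + ∑ g
  ∑-+ = Sum.∑-distrib-+

  ∑-comm : (f : Fin m → Fin n → ℕ) → ∑ (λ i → ∑ (f i)) ≡ ∑ (λ j → ∑ λ i → f i j)
  ∑-comm = Sum.∑-comm

  *-∑ : ∀ k (f : Fin n → ℕ) → k * ∑ f ≡ ∑ (λ i → k * f i)
  *-∑ = Sum.*-distribˡ-sum

  ∑-* : ∀ (f : Fin n → ℕ) k → ∑ f * k ≡ ∑ (λ i → f i * k)
  ∑-* f k = Sum.*-distribʳ-sum k f

  ∑-permute : ∀ (f : Fin n → ℕ) (π : Fin m ↔ Fin n) → ∑ f ≡ ∑ (f ∘ Inverse.to π)
  ∑-permute = Sum.sum-permute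

  ∑-mono : {f g : Fin n → ℕ} → (∀ i → f i ≤ g i) → ∑ f ≤ ∑ g
  ∑-mono {zero}  f≤g = z≤n
  ∑-mono {suc n} f≤g = ℕ.+-mono-≤ (f≤g zero) (∑-mono (f≤g ∘ suc))

  ∑-mono-< : {f g : Fin n → ℕ} → (∀ i → f i ≤ g i) → ∀ i → f i < g i → ∑ f < ∑ g
  ∑-mono-< f≤g zero    f<g = ℕ.+-mono-<-≤ f<g (∑-mono (f≤g ∘ suc))
  ∑-mono-< f≤g (suc i) f<g = ℕ.+-mono-≤-< (f≤g zero) (∑-mono-< (f≤g ∘ suc) i f<g)

  ∑-const : ∀ n k → ∑ {n} (λ _ → k) ≡ n * k
  ∑-const zero    k = refl
  ∑-const (suc n) k = cong (k +_) (∑-const n k)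

  ∑-zero : (f : Fin 0 → ℕ) → ∑ f ≡ 0
  ∑-zero f = refl

  ∑-suc : (f : Fin (suc n) → ℕ) → ∑ f ≡ f zero + ∑ (f ∘ suc)
  ∑-suc f = refl

  term≤∑ : (f : Fin n → ℕ) → ∀ i → f i ≤ ∑ f
  term≤∑ f zero    = ℕ.m≤m+n _ _
  term≤∑ f (suc i) = ℕ.≤-trans (term≤∑ (f ∘ suc) i) (ℕ.m≤n+m _ (f zero))

-- Predicates rather than bit vectors: set operations are pointwise, and a cardinality is a sum of
-- indicators, to which double counting applies directly.
Subsetᵇ : ℕ → Set
Subsetᵇ n = Fin n → Bool

ind : Bool → ℕ
ind b = if b then 1 else 0

ind-mono : ∀ {a b} → (a ≡ true → b ≡ true) → ind a ≤ ind b
ind-mono {false}        _   = z≤n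
ind-mono {true} {true}  _   = ℕ.≤-refl
ind-mono {true} {false} a⇒b with () ← a⇒b refl

count : Subsetᵇ n → ℕ
count P = ∑ (ind ∘ P)

infix  9 ⁅_⁆
infixl 6 _∖_
infix  4 _⊆_

⁅_⁆ : Fin n → Subsetᵇ n
⁅ v ⁆ u = does (u ≟ v)

_∖_ : Subsetᵇ n → Subsetᵇ n → Subsetᵇ n
(P ∖ Q) v = P v ∧ not (Q v)

_⊆_ : Subsetᵇ n → Subsetᵇ n → Set
P ⊆ Q = ∀ v → P v ≡ true → Q v ≡ true

does⁻ : ∀ {A : Set} (A? : Dec A) → does A? ≡ true → A
does⁻ (yes a) _ = a

false≢true : ∀ {b} → b ≡ false → ¬ b ≡ true
false≢true refl ()

bool-ext : ∀ {a b} → (a ≡ true → b ≡ true) → (b ≡ true → a ≡ true) → a ≡ b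
bool-ext {true}  {b}     f g = sym (f refl)
bool-ext {false} {false} f g = refl
bool-ext {false} {true}  f g = g refl

≢true : ∀ {b} → ¬ b ≡ true → b ≡ false
≢true {false} _  = refl
≢true {true}  ¬b = contradiction refl ¬b

∧⁺ : ∀ {a b} → a ≡ true → b ≡ true → a ∧ b ≡ true
∧⁺ refl refl = refl

∧⁻ : ∀ {a b} → a ∧ b ≡ true → a ≡ true × b ≡ true
∧⁻ {true} {true} _ = refl , refl

not⁻ : ∀ {a} → not a ≡ true → a ≡ false
not⁻ {false} _ = refl

not⁺ : ∀ {a} → ¬ a ≡ true → not a ≡ true
not⁺ {true}  ¬a = contradiction refl ¬a
not⁺ {false} _  = refl

∖⁺ : ∀ {P Q : Subsetᵇ n} {v} → P v ≡ true → ¬ Q v ≡ true → (P ∖ Q) v ≡ true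
∖⁺ p ¬q = ∧⁺ p (not⁺ ¬q)

∖⁻ : ∀ {P Q : Subsetᵇ n} v → (P ∖ Q) v ≡ true → P v ≡ true × ¬ Q v ≡ true
∖⁻ {P = P} {Q} v pq with P v | Q v
... | true | false = refl , λ ()

∖-⊆ : ∀ {P Q : Subsetᵇ n} → P ∖ Q ⊆ P
∖-⊆ {P = P} {Q} v v∈ = proj₁ (∖⁻ {P = P} {Q} v v∈)

⁅⁆⁻ : ∀ {u v : Fin n} → ⁅ v ⁆ u ≡ true → u ≡ v
⁅⁆⁻ = does⁻ (_ ≟ _)

⁅⁆⁺ : ∀ (v : Fin n) → ⁅ v ⁆ v ≡ true
⁅⁆⁺ v = dec-true (v ≟ v) refl

∑-⁅⁆ : ∀ (v : Fin n) (h : Fin n → ℕ) → ∑ (λ u → ind (⁅ v ⁆ u) * h u) ≡ h v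
∑-⁅⁆ {suc n} zero h = trans (∑-suc _) (trans
  (cong₂ _+_ (ℕ.*-identityˡ (h zero)) (trans (∑-const n 0) (ℕ.*-zeroʳ n)))
  (ℕ.+-identityʳ (h zero)))
∑-⁅⁆ (suc v) h = trans (∑-suc _) (∑-⁅⁆ v (h ∘ suc))

∑-0 : {f : Fin n → ℕ} → (∀ i → f i ≡ 0) → ∑ f ≡ 0
∑-0 {n} f≡0 = trans (∑-cong f≡0) (trans (∑-const n 0) (ℕ.*-zeroʳ n))

count-⁅⁆ : ∀ (v : Fin n) → count ⁅ v ⁆ ≡ 1
count-⁅⁆ v = trans (∑-cong λ u → sym (ℕ.*-identityʳ (ind (⁅ v ⁆ u)))) (∑-⁅⁆ v (λ _ → 1))

count-mono : {P Q : Subsetᵇ n} → P ⊆ Q → count P ≤ count Q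
count-mono P⊆Q = ∑-mono λ v → ind-mono (P⊆Q v)

count≤n : (P : Subsetᵇ n) → count P ≤ n
count≤n {n} P = subst (count P ≤_) (trans (∑-const n 1) (ℕ.*-identityʳ n))
  (count-mono {P = P} {λ _ → true} λ _ _ → refl)

count-∖ : {P Q : Subsetᵇ n} → Q ⊆ P → count P ≡ count Q + count (P ∖ Q)
count-∖ {P = P} {Q} Q⊆P = trans (∑-cong λ v → pointwise (Q⊆P v)) (∑-+ _ _)
  where
  pointwise : ∀ {p q} → (q ≡ true → p ≡ true) → ind p ≡ ind q + ind (p ∧ not q)
  pointwise {true}  {true}  _   = refl
  pointwise {true}  {false} _   = refl
  pointwise {false} {false} _   = refl
  pointwise {false} {true}  q⇒p with () ← q⇒p refl

⁅⁆⊆ : ∀ {P : Subsetᵇ n} {v} → P v ≡ true → ⁅ v ⁆ ⊆ P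
⁅⁆⊆ {P = P} p u u∈ = subst (λ w → P w ≡ true) (sym (⁅⁆⁻ u∈)) p

count-remove : ∀ {P : Subsetᵇ n} {v} → P v ≡ true → count P ≡ suc (count (P ∖ ⁅ v ⁆))
count-remove {P = P} {v} p =
  trans (count-∖ {P = P} {⁅ v ⁆} (⁅⁆⊆ {P = P} p)) (cong (_+ count (P ∖ ⁅ v ⁆)) (count-⁅⁆ v))

count-pos : ∀ {P : Subsetᵇ n} {v} → P v ≡ true → 1 ≤ count P
count-pos {P = P} {v} p = subst (λ b → ind b ≤ count P) p (term≤∑ (ind ∘ P) v)

empty⊎member : (P : Subsetᵇ n) → count P ≡ 0 ⊎ ∃[ v ] P v ≡ true
empty⊎member {n} P with any? (λ v → P v ≟ᵇ true)
... | yes found = inj₂ found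
... | no ∄ = inj₁ (ℕ.n≤0⇒n≡0 (ℕ.≤-trans
  (count-mono {P = P} {λ _ → false} λ v p → contradiction (v , p) ∄)
  (ℕ.≤-reflexive (trans (∑-const n 0) (ℕ.*-zeroʳ n)))))

-- Matchings as involutions; adding and removing an edge.

opaque
  -- For a mate function, `a = y` and `b = x` add the edge xy, while `a = x` and `b = y` remove it.
  update : (Fin n → Fin n) → (x a y b : Fin n) → Fin n → Fin n
  update f x a y b v = if does (v ≟ x) then a else if does (v ≟ y) then b else f v

  update-fst : ∀ (f : Fin n → Fin n) {x a y b} → update f x a y b x ≡ a
  update-fst f {x} rewrite dec-true (x ≟ x) refl = refl

  update-snd : ∀ (f : Fin n → Fin n) {x a y b} → y ≢ x → update f x a y b y ≡ b
  update-snd f {x} {y = y} y≢x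
    rewrite dec-false (y ≟ x) y≢x | dec-true (y ≟ y) refl = refl

  update-other : ∀ (f : Fin n → Fin n) {x a y b v} → v ≢ x → v ≢ y →
                 update f x a y b v ≡ f v
  update-other f {x} {y = y} {v = v} v≢x v≢y
    rewrite dec-false (v ≟ x) v≢x | dec-false (v ≟ y) v≢y = refl

  -- The matching laws and the sizes of `link` and `unlink` are instances of this, each for a
  -- suitable relation `Q` between a vertex and its new mate.
  update-elim : ∀ (f : Fin n → Fin n) {x a y b} (Q : Fin n → Fin n → Set) →
                Q x a → (y ≢ x → Q y b) → (∀ v → v ≢ x → v ≢ y → Q v (f v)) →
                ∀ v → Q v (update f x a y b v)
  update-elim f {x} {y = y} Q qx qy qv v with v ≟ x
  ... | yes refl = qx
  ... | no v≢x with v ≟ y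
  ...   | yes refl = qy v≢x
  ...   | no v≢y = qv v v≢x v≢y

moves : (Fin n → Fin n) → Subsetᵇ n
moves f v = not (does (f v ≟ v))

moves⁺ : ∀ {f : Fin n → Fin n} {v} → f v ≢ v → moves f v ≡ true
moves⁺ {f = f} {v} fv≢v = cong not (dec-false (f v ≟ v) fv≢v)

moves⁻ : ∀ {f : Fin n → Fin n} {v} → moves f v ≡ true → f v ≢ v
moves⁻ {f = f} {v} m fv≡v = false≢true (not⁻ m) (dec-true (f v ≟ v) fv≡v)

⁅⁆-false : ∀ {u v : Fin n} → u ≢ v → ⁅ v ⁆ u ≡ false
⁅⁆-false {u = u} {v} u≢v = dec-false (u ≟ v) u≢v

fixes : ∀ {f : Fin n → Fin n} {v} → f v ≡ v → moves f v ≡ false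
fixes {f = f} {v} fv≡v = cong not (dec-true (f v ≟ v) fv≡v)

∑-pair : ∀ (f : Fin n → ℕ) x y →
         ∑ (λ v → f v + (ind (⁅ x ⁆ v) + ind (⁅ y ⁆ v))) ≡ ∑ f + 2
∑-pair f x y = trans (∑-+ f _) (cong (∑ f +_)
  (trans (∑-+ _ _) (cong₂ _+_ (count-⁅⁆ x) (count-⁅⁆ y))))

module _ (G : Graph n) where
  open Graph G

  -- A matching of the subgraph induced by P, as the involution that exchanges the
  -- ends of its edges; size counts covered vertices, i.e. twice the edges.
  record Mate (P : Subsetᵇ n) : Set where
    field
      mate       : Fin n → Fin n
      involutive : ∀ v → mate (mate v) ≡ v
      edge       : ∀ v → mate v ≢ v → v ~ mate v
      inside     : ∀ v → mate v ≢ v → P v ≡ true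

    size : ℕ
    size = count (moves mate)

open Mate

module _ {G : Graph n} where
  open Graph G

  ~⇒≢ : ∀ {u v} → u ~ v → u ≢ v
  ~⇒≢ u~v refl = irrefl u~v

  empty : ∀ {P} → Mate G P
  empty .mate v = v
  empty .involutive v = refl
  empty .edge v v≢v = contradiction refl v≢v
  empty .inside v v≢v = contradiction refl v≢v

  size-empty : ∀ {P} → size (empty {P}) ≡ 0
  size-empty = trans (∑-cong λ v → cong ind (fixes {f = λ v → v} {v} refl))
    (trans (∑-const n 0) (ℕ.*-zeroʳ n))

  module _ {P : Subsetᵇ n} (M : Mate G P) where

    mate-moved : ∀ {v} → mate M v ≢ v → mate M (mate M v) ≢ mate M v
    mate-moved {v} moved eq = moved (trans (sym eq) (involutive M v))

    mate-injective : ∀ {u v} → mate M u ≡ mate M v → u ≡ v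
    mate-injective {u} {v} eq =
      trans (sym (involutive M u)) (trans (cong (mate M) eq) (involutive M v))

    module _ {x y} (x~y : x ~ y) (px : P x ≡ true) (py : P y ≡ true)
             (x-free : mate M x ≡ x) (y-free : mate M y ≡ y) where
      private
        f = mate M
        f′ = update f x y y x

        y≢x : y ≢ x
        y≢x = ~⇒≢ (~-sym x~y)

      link : Mate G P
      link .mate = f′
      link .involutive = update-elim f (λ v w → f′ w ≡ v)
        (update-snd f y≢x) (λ _ → update-fst f)
        λ v v≢x v≢y → trans
          (update-other f
            (λ fv≡x → v≢x (mate-injective (trans fv≡x (sym x-free))))
            (λ fv≡y → v≢y (mate-injective (trans fv≡y (sym y-free)))))
          (involutive M v)
      link .edge = update-elim f (λ v w → w ≢ v → v ~ w)
        (λ _ → x~y) (λ _ _ → ~-sym x~y) λ v _ _ → edge M v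
      link .inside = update-elim f (λ v w → w ≢ v → P v ≡ true)
        (λ _ → px) (λ _ _ → py) λ v _ _ → inside M v

      size-link : size link ≡ size M + 2
      size-link = trans (∑-cong (update-elim f
        (λ v w → ind (not (does (w ≟ v))) ≡ ind (moves f v) + (ind (⁅ x ⁆ v) + ind (⁅ y ⁆ v)))
        (at-x) at-y
        λ v v≢x v≢y → sym (trans
          (cong₂ (λ a b → ind (moves f v) + (ind a + ind b)) (⁅⁆-false v≢x) (⁅⁆-false v≢y))
          (ℕ.+-identityʳ _))))
        (∑-pair (ind ∘ moves f) x y)
        where
        at-x : ind (not (does (y ≟ x))) ≡ ind (moves f x) + (ind (⁅ x ⁆ x) + ind (⁅ y ⁆ x))
        at-x rewrite fixes {f = f} x-free | ⁅⁆⁺ x | dec-false (y ≟ x) y≢x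
          | ⁅⁆-false (≢-sym y≢x) = refl

        at-y : y ≢ x → ind (not (does (x ≟ y))) ≡ ind (moves f y) + (ind (⁅ x ⁆ y) + ind (⁅ y ⁆ y))
        at-y _ rewrite fixes {f = f} y-free | ⁅⁆⁺ y | dec-false (x ≟ y) (≢-sym y≢x)
          | ⁅⁆-false y≢x = refl

    module _ {x} (x-moved : mate M x ≢ x) where
      private
        f = mate M
        y = f x
        f′ = update f x x y y

        fy≡x : f y ≡ x
        fy≡x = involutive M x

      unlink : Mate G P
      unlink .mate = f′
      unlink .involutive = update-elim f (λ v w → f′ w ≡ v)
        (update-fst f) (update-snd f)
        λ v v≢x v≢y → trans
          (update-other f
            (λ fv≡x → v≢y (mate-injective (trans fv≡x (sym fy≡x))))
            (λ fv≡y → v≢x (mate-injective fv≡y)))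
          (involutive M v)
      unlink .edge = update-elim f (λ v w → w ≢ v → v ~ w)
        (contradiction refl) (λ _ → contradiction refl) λ v _ _ → edge M v
      unlink .inside = update-elim f (λ v w → w ≢ v → P v ≡ true)
        (contradiction refl) (λ _ → contradiction refl) λ v _ _ → inside M v

      unlink-fst : mate unlink x ≡ x
      unlink-fst = update-fst f

      unlink-snd : mate unlink y ≡ y
      unlink-snd = update-snd f x-moved

      unlink-fixed : ∀ {v} → mate M v ≡ v → mate unlink v ≡ v
      unlink-fixed {v} fv≡v = update-elim f (λ v w → f v ≡ v → w ≡ v)
        (λ _ → refl) (λ _ _ → refl) (λ _ _ _ eq → eq) v fv≡v

      size-unlink : size M ≡ size unlink + 2
      size-unlink = trans (∑-cong (update-elim f
        (λ v w → ind (moves f v) ≡ ind (not (does (w ≟ v))) + (ind (⁅ x ⁆ v) + ind (⁅ y ⁆ v)))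
        at-x at-y
        λ v v≢x v≢y → sym (trans
          (cong₂ (λ a b → ind (moves f v) + (ind a + ind b)) (⁅⁆-false v≢x) (⁅⁆-false v≢y))
          (ℕ.+-identityʳ _))))
        (∑-pair (ind ∘ moves f′) x y)
        where
        at-x : ind (moves f x) ≡ ind (not (does (x ≟ x))) + (ind (⁅ x ⁆ x) + ind (⁅ y ⁆ x))
        at-x rewrite moves⁺ {f = f} x-moved | dec-true (x ≟ x) refl
          | ⁅⁆-false (≢-sym x-moved) = refl

        at-y : y ≢ x → ind (moves f y) ≡ ind (not (does (y ≟ y))) + (ind (⁅ x ⁆ y) + ind (⁅ y ⁆ y))
        at-y _ rewrite moves⁺ {f = f} (mate-moved x-moved) | dec-true (y ≟ y) refl
          | ⁅⁆-false x-moved = refl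

-- Induced subgraphs, and the transfer of independent sets and matchings.

∣tabulate∣ : (T : Subsetᵇ n) → Subset.∣ tabulate T ∣ ≡ count T
∣tabulate∣ {zero}  T = sym (∑-zero _)
∣tabulate∣ {suc n} T with T zero in eq
... | true  = trans (cong suc (∣tabulate∣ (T ∘ suc)))
  (sym (trans (∑-suc _) (cong (λ b → ind b + count (T ∘ suc)) eq)))
... | false = trans (∣tabulate∣ (T ∘ suc))
  (sym (trans (∑-suc _) (cong (λ b → ind b + count (T ∘ suc)) eq)))

∣_∣≡count : (S : Subset.Subset n) → Subset.∣ S ∣ ≡ count (lookup S)
∣ [] ∣≡count        = sym (∑-zero _)
∣ true  ∷ S ∣≡count = trans (cong suc ∣ S ∣≡count) (sym (∑-suc _))
∣ false ∷ S ∣≡count = trans ∣ S ∣≡count (sym (∑-suc _))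

element : (S : Subset.Subset n) → Fin Subset.∣ S ∣ → Fin n
element S = lookup (elements S)

private
  element-suc : ∀ (S : Subset.Subset n) i →
                lookup (Vec.map Fin.suc (elements S)) i ≡ Fin.suc (element S i)
  element-suc S i = lookup-map i Fin.suc (elements S)

element-∈ : ∀ (S : Subset.Subset n) i → lookup S (element S i) ≡ true
element-∈ (true  ∷ S) zero    = refl
element-∈ (true  ∷ S) (suc i) =
  trans (cong (lookup (true ∷ S)) (element-suc S i)) (element-∈ S i)
element-∈ (false ∷ S) i       =
  trans (cong (lookup (false ∷ S)) (element-suc S i)) (element-∈ S i)

element-injective : ∀ (S : Subset.Subset n) {i j} → element S i ≡ element S j → i ≡ j
element-injective (true ∷ S) {zero}  {zero}  eq = refl
element-injective (true ∷ S) {zero}  {suc j} eq =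
  contradiction (trans eq (element-suc S j)) λ ()
element-injective (true ∷ S) {suc i} {zero}  eq =
  contradiction (trans (sym eq) (element-suc S i)) λ ()
element-injective (true ∷ S) {suc i} {suc j} eq = cong suc (element-injective S
  (suc-injective (trans (sym (element-suc S i)) (trans eq (element-suc S j)))))
element-injective (false ∷ S) {i} {j} eq = element-injective S
  (suc-injective (trans (sym (element-suc S i)) (trans eq (element-suc S j))))

element-onto : ∀ (S : Subset.Subset n) v → lookup S v ≡ true → ∃[ i ] element S i ≡ v
element-onto (true  ∷ S) zero    _ = zero , refl
element-onto (true  ∷ S) (suc v) v∈ with i , refl ← element-onto S v v∈ =
  suc i , element-suc S i
element-onto (false ∷ S) (suc v) v∈ with i , refl ← element-onto S v v∈ =
  i , element-suc S i

∑-element : ∀ (S : Subset.Subset n) (f : Fin n → ℕ) →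
            ∑ (f ∘ element S) ≡ ∑ (λ v → ind (lookup S v) * f v)
∑-element [] f = trans (∑-zero _) (sym (∑-zero _))
∑-element (true ∷ S) f = trans (∑-suc _) (trans
  (cong₂ _+_ (sym (ℕ.*-identityˡ (f zero)))
    (trans (∑-cong λ i → cong f (element-suc S i)) (∑-element S (f ∘ suc))))
  (sym (∑-suc _)))
∑-element (false ∷ S) f = trans
  (∑-cong λ i → cong f (element-suc S i))
  (trans (∑-element S (f ∘ suc)) (sym (∑-suc _)))

-- H is, up to isomorphism, the subgraph of G induced by P.
record Presents (H : Graph m) (G : Graph n) (P : Subsetᵇ n) : Set where
  private
    module H = Graph H
    module G = Graph G
  field
    embed     : Fin m → Fin n
    injective : ∀ {i j} → embed i ≡ embed j → i ≡ j
    ∈P        : ∀ i → P (embed i) ≡ true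
    onto      : ∀ v → P v ≡ true → ∃[ i ] embed i ≡ v
    adj⁺      : ∀ {i j} → i H.~ j → embed i G.~ embed j
    adj⁻      : ∀ {i j} → embed i G.~ embed j → i H.~ j
    ∑-embed   : ∀ f → ∑ (f ∘ embed) ≡ ∑ (λ v → ind (P v) * f v)

presents-induced : ∀ (G : Graph n) S {P} → (∀ v → lookup S v ≡ P v) → Presents (G [ S ]) G P
presents-induced G S {P} S≗P = record
  { embed     = element S
  ; injective = element-injective S
  ; ∈P        = λ i → trans (sym (S≗P _)) (element-∈ S i)
  ; onto      = λ v v∈ → element-onto S v (trans (S≗P v) v∈)
  ; adj⁺      = λ i~j → i~j
  ; adj⁻      = λ i~j → i~j
  ; ∑-embed   = λ f → trans (∑-element S f) (∑-cong λ v → cong (λ b → ind b * f v) (S≗P v))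
  }

full : Subsetᵇ n
full _ = true

count-full : count {n} full ≡ n
count-full {n} = trans (∑-const n 1) (ℕ.*-identityʳ n)

presents-self : ∀ (G : Graph n) → Presents G G full
presents-self G = record
  { embed     = λ v → v
  ; injective = λ eq → eq
  ; ∈P        = λ _ → refl
  ; onto      = λ v _ → v , refl
  ; adj⁺      = λ i~j → i~j
  ; adj⁻      = λ i~j → i~j
  ; ∑-embed   = λ f → ∑-cong λ v → sym (ℕ.*-identityˡ (f v))
  }

∑-⊆ : ∀ {T P : Subsetᵇ n} → T ⊆ P → ∑ (λ v → ind (P v) * ind (T v)) ≡ count T
∑-⊆ {T = T} {P} T⊆P = ∑-cong λ v → pointwise (T⊆P v)
  where
  pointwise : ∀ {t p} → (t ≡ true → p ≡ true) → ind p * ind t ≡ ind t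
  pointwise {t} {true}       _   = ℕ.*-identityˡ (ind t)
  pointwise {false} {false}  _   = refl
  pointwise {true}  {false}  t⇒p with () ← t⇒p refl

module _ (G : Graph n) where
  open Graph G

  Indep : Subsetᵇ n → Set
  Indep T = ∀ u v → T u ≡ true → T v ≡ true → ¬ u ~ v

  IndepIn : Subsetᵇ n → ℕ → Set
  IndepIn P k = ∃[ T ] (T ⊆ P × Indep T × count T ≡ k)

insert : Fin n → Subsetᵇ n → Subsetᵇ n
insert v T u = ⁅ v ⁆ u ∨ T u

module _ {v : Fin n} {T : Subsetᵇ n} where

  insert⁻ : ∀ {u} → insert v T u ≡ true → u ≡ v ⊎ T u ≡ true
  insert⁻ {u} t with u ≟ v
  ... | yes u≡v = inj₁ u≡v
  ... | no _    = inj₂ t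

  insert-⊆ : T ⊆ insert v T
  insert-⊆ u tu = trans (cong (⁅ v ⁆ u ∨_) tu) (∨-zeroʳ _)

  count-insert : ¬ T v ≡ true → count (insert v T) ≡ suc (count T)
  count-insert v∉T = trans (∑-cong pointwise) (trans (∑-+ _ _) (cong (_+ count T) (count-⁅⁆ v)))
    where
    pointwise : ∀ u → ind (insert v T u) ≡ ind (⁅ v ⁆ u) + ind (T u)
    pointwise u with u ≟ v
    ... | yes refl = cong (suc ∘ ind) (sym (≢true v∉T))
    ... | no _     = refl

insert-indep : ∀ {G : Graph n} {v T} → Indep G T → (∀ u → T u ≡ true → ¬ Graph._~_ G v u) →
               Indep G (insert v T)
insert-indep {G = G} {v} {T} T-indep v≁T u w u∈ w∈ u~w
  with insert⁻ {v = v} {T} u∈ | insert⁻ {v = v} {T} w∈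
... | inj₁ refl | inj₁ refl = Graph.irrefl G u~w
... | inj₁ refl | inj₂ tw   = v≁T w tw u~w
... | inj₂ tu   | inj₁ refl = v≁T u tu (Graph.~-sym G u~w)
... | inj₂ tu   | inj₂ tw   = T-indep u w tu tw u~w

module _ {H : Graph m} {G : Graph n} {P : Subsetᵇ n} (H≼G : Presents H G P) where
  private
    module H = Graph H
    module G = Graph G
  open Presents H≼G

  module _ (S : Subsetᵇ m) where
    private
      preimage? : ∀ v → Dec (∃[ i ] (embed i ≡ v × S i ≡ true))
      preimage? v = any? λ i → (embed i ≟ v) ×-dec (S i ≟ᵇ true)

    image : Subsetᵇ n
    image v = does (preimage? v)

    image⁻ : ∀ {v} → image v ≡ true → ∃[ i ] (embed i ≡ v × S i ≡ true)
    image⁻ {v} = does⁻ (preimage? v)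

    image⁺ : ∀ {i} → S i ≡ true → image (embed i) ≡ true
    image⁺ {i} s = dec-true (preimage? _) (i , refl , s)

    image⊆P : image ⊆ P
    image⊆P v v∈ with i , refl , _ ← image⁻ v∈ = ∈P i

    count-image : count image ≡ count S
    count-image = trans (sym (trans (∑-embed _) (∑-⊆ image⊆P)))
      (∑-cong λ i → cong ind (bool-ext
        (λ i∈ → case image⁻ i∈ of λ (j , eq , s) → subst (λ k → S k ≡ true) (injective eq) s)
        image⁺))

  α-attained : IndepIn G P (α H)
  α-attained with independenceNumber H
  ... | _ , (S , S-indep , refl) , _ =
    image (lookup S) , image⊆P (lookup S) , indep ,
    trans (count-image (lookup S)) (sym ∣ S ∣≡count)
    where
    indep : Indep G (image (lookup S))
    indep u v u∈ v∈ u~v with image⁻ (lookup S) u∈ | image⁻ (lookup S) v∈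
    ... | i , refl , i∈ | j , refl , j∈ =
      S-indep i j (lookup⇒[]= i S i∈) (lookup⇒[]= j S j∈) (adj⁻ u~v)

  α-maximal : ∀ {k} → IndepIn G P k → k ≤ α H
  α-maximal (T , T⊆P , T-indep , refl) = proj₂ (proj₂ (independenceNumber H))
    ( tabulate (T ∘ embed)
    , (λ i j i∈ j∈ i~j → T-indep _ _ (∈T i∈) (∈T j∈) (adj⁺ i~j))
    , trans (∣tabulate∣ _) (trans (∑-embed (ind ∘ T)) (∑-⊆ T⊆P))
    )
    where
    ∈T : ∀ {i} → i Subset.∈ tabulate (T ∘ embed) → T (embed i) ≡ true
    ∈T {i} i∈ = trans (sym (lookup∘tabulate _ i)) ([]=⇒lookup i∈)

  -- Peels off one edge at a time with `unlink`. The last clause carries the disjointness: vertices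
  -- listed from the remaining matching are moved by it, whereas both ends of the edge just removed
  -- are fixed by it.
  mate→matching : ∀ k (M : Mate G P) → size M ≤ k →
    ∃[ j ] (j * 2 ≡ size M × Σ[ V ∈ Vec (Fin m × Fin m) j ] (Matching H V ×
      All (λ (c , d) → mate M (embed c) ≢ embed c × mate M (embed d) ≢ embed d) V))
  mate→matching k M size≤k with empty⊎member (moves (mate M))
  ... | inj₁ size≡0 = 0 , sym size≡0 , [] , ([] , []) , []
  mate→matching zero M size≤k | inj₂ (v , v∈) =
    contradiction (ℕ.≤-trans (count-pos v∈) size≤k) λ ()
  mate→matching (suc k) M size≤k | inj₂ (v , v∈) = step
    where
    v-moved = moves⁻ {f = mate M} {v} v∈
    M′ = unlink M v-moved

    step : ∃[ j ] _
    step with onto v (inside M v v-moved)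
            | onto (mate M v) (inside M (mate M v) (mate-moved M v-moved))
            | mate→matching k M′ (ℕ.≤-trans (ℕ.n≤1+n _) (s≤s⁻¹
                (subst (_≤ suc k) (trans (size-unlink M v-moved) (ℕ.+-comm _ 2)) size≤k)))
    ... | a , refl | b , eb≡ | j , size≡ , V , (V-edges , V-disjoint) , V-moved =
      suc j ,
      trans (cong (2 +_) size≡) (trans (ℕ.+-comm 2 _) (sym (size-unlink M v-moved))) ,
      (a , b) ∷ V ,
      ( adj⁻ (subst (embed a G.~_) (sym eb≡) (edge M v v-moved)) ∷ V-edges
      , All.map (λ (c-moved , d-moved) →
          (λ { refl → c-moved a-fixed }) , (λ { refl → d-moved a-fixed }) ,
          (λ { refl → c-moved b-fixed }) , (λ { refl → d-moved b-fixed })) V-moved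
        ∷ V-disjoint ) ,
      (v-moved , λ eq → mate-moved M v-moved (subst (λ w → mate M w ≡ w) eb≡ eq))
      ∷ All.map (λ (c-moved , d-moved) →
          c-moved ∘ unlink-fixed M v-moved , d-moved ∘ unlink-fixed M v-moved) V-moved
      where
      a-fixed : mate M′ (embed a) ≡ embed a
      a-fixed = unlink-fst M v-moved

      b-fixed : mate M′ (embed b) ≡ embed b
      b-fixed = subst (λ w → mate M′ w ≡ w) (sym eb≡) (unlink-snd M v-moved)

  -- The last clause is the invariant that frees the ends of the next edge, as `link` requires.
  matching→mate : ∀ {k} (V : Vec (Fin m × Fin m) k) → Matching H V →
    Σ[ M ∈ Mate G P ] (size M ≡ k * 2 ×
      (∀ v → All (λ (c , d) → v ≢ embed c × v ≢ embed d) V → mate M v ≡ v))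
  matching→mate [] _ = empty , size-empty {G = G} {P} , λ _ _ → refl
  matching→mate ((a , b) ∷ V) (a~b ∷ V-edges , ab-disjoint ∷ V-disjoint)
    with matching→mate V (V-edges , V-disjoint)
  ... | M , size≡ , fixed =
    link M (adj⁺ a~b) (∈P a) (∈P b) a-free b-free ,
    trans (size-link M (adj⁺ a~b) (∈P a) (∈P b) a-free b-free)
      (trans (cong (_+ 2) size≡) (ℕ.+-comm _ 2)) ,
    λ { v ((v≢a , v≢b) ∷ rest) → trans (update-other (mate M) v≢a v≢b) (fixed v rest) }
    where
    a-free = fixed (embed a) (All.map (λ (a≢c , a≢d , _) →
      a≢c ∘ injective , a≢d ∘ injective) ab-disjoint)
    b-free = fixed (embed b) (All.map (λ (_ , _ , b≢c , b≢d) →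
      b≢c ∘ injective , b≢d ∘ injective) ab-disjoint)

  β-attained : Σ[ M ∈ Mate G P ] size M ≡ β H * 2
  β-attained with matchingNumber H
  ... | _ , (V , V-matching) , _ with M , size≡ , _ ← matching→mate V V-matching = M , size≡

  β-maximal : (M : Mate G P) → size M ≤ β H * 2
  β-maximal M with mate→matching (size M) M ℕ.≤-refl
  ... | j , size≡ , V , V-matching , _ = subst (_≤ β H * 2) size≡
    (ℕ.*-monoˡ-≤ 2 (proj₂ (proj₂ (matchingNumber H)) (V , V-matching)))

-- Shearer's lower bound for the independence number.

-- Shearer's weights, scaled by 850: f 0 = 1 and (d² + 1) f d = 1 + (d² - d) f (d - 1)
-- for d ≤ 4. Truncating to zero beyond 4 keeps every inequality below.
-- slope d = weight (d - 1) - weight d for 1 ≤ d ≤ 4; the values elsewhere keep it antitone.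
weight slope : ℕ → ℕ
weight 0 = 850
weight 1 = 425
weight 2 = 340
weight 3 = 289
weight 4 = 254
weight (suc (suc (suc (suc (suc _))))) = 0
slope 0 = 425
slope 1 = 425
slope 2 = 85
slope 3 = 51
slope 4 = 35
slope (suc (suc (suc (suc (suc _))))) = 0

private
  5≤⇒weight≡0 : ∀ {d} → 5 ≤ d → weight d ≡ 0
  5≤⇒weight≡0 (s≤s (s≤s (s≤s (s≤s (s≤s _))))) = refl

  5≤⇒slope≡0 : ∀ {d} → 5 ≤ d → slope d ≡ 0
  5≤⇒slope≡0 (s≤s (s≤s (s≤s (s≤s (s≤s _))))) = refl

  convex? : ∀ d c d′ → Dec (d′ + c ≤ d → weight d + c * slope d ≤ weight d′)
  convex? d c d′ = (d′ + c ℕ.≤? d) →-dec (weight d + c * slope d ℕ.≤? weight d′)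

  antitone? : ∀ d d′ → Dec (d ≤ d′ → slope d′ ≤ slope d)
  antitone? d d′ = (d ℕ.≤? d′) →-dec (slope d′ ℕ.≤? slope d)

  balance? : ∀ d → Dec (weight d + d * slope d + d * weight d ≤ 850 + d * (d * slope d))
  balance? d = _ ℕ.≤? _

-- Convexity in tangent form: slopes only grow as the degree falls, so each unit of a decrease
-- starting at `d` gains at least `slope d`. Below 5 this is a finite check; from 5 on the left side
-- vanishes.
weight-convex : ∀ d c d′ → d′ + c ≤ d → weight d + c * slope d ≤ weight d′
weight-convex d c d′ d′+c≤d with d ℕ.<? 5
... | yes d<5 = from-yes
  (ℕ.allUpTo? (λ x → ℕ.allUpTo? (λ y → ℕ.allUpTo? (convex? x y) 5) 5) 5)
  d<5 (ℕ.≤-<-trans (ℕ.m+n≤o⇒n≤o d′ d′+c≤d) d<5) (ℕ.≤-<-trans (ℕ.m+n≤o⇒m≤o d′ d′+c≤d) d<5) d′+c≤d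
... | no d≮5 rewrite 5≤⇒weight≡0 (ℕ.≮⇒≥ d≮5) | 5≤⇒slope≡0 (ℕ.≮⇒≥ d≮5) | ℕ.*-zeroʳ c = z≤n

slope-antitone : ∀ {d d′} → d ≤ d′ → slope d′ ≤ slope d
slope-antitone {d} {d′} d≤d′ with d′ ℕ.<? 5
... | yes d′<5 = from-yes (ℕ.allUpTo? (λ x → ℕ.allUpTo? (antitone? x) 5) 5)
  (ℕ.≤-<-trans d≤d′ d′<5) d′<5 d≤d′
... | no d′≮5 rewrite 5≤⇒slope≡0 (ℕ.≮⇒≥ d′≮5) = z≤n

private
  rearrangement-ordered : ∀ {a b} → a ≤ b →
    a * slope a + b * slope b ≤ b * slope a + a * slope b
  rearrangement-ordered {a} {b} a≤b
    with k , refl ← ℕ.m≤n⇒∃[o]m+o≡n a≤b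
    with l , eq ← ℕ.m≤n⇒∃[o]m+o≡n (slope-antitone a≤b)
    rewrite sym eq = subst (a * (slope b + l) + b * slope b ≤_)
      (identity a k (slope b) l) (ℕ.m≤m+n _ (k * l))
    where
    identity : ∀ a k s l → a * (s + l) + (a + k) * s + k * l ≡ (a + k) * (s + l) + a * s
    identity = solve-∀

-- The right side exceeds the left by `(b - a) * (slope a - slope b)`, whose factors have the same
-- sign because `slope` is antitone.
slope-rearrangement : ∀ a b → a * slope a + b * slope b ≤ b * slope a + a * slope b
slope-rearrangement a b with ℕ.≤-total a b
... | inj₁ a≤b = rearrangement-ordered a≤b
... | inj₂ b≤a rewrite ℕ.+-comm (a * slope a) (b * slope b)
                     | ℕ.+-comm (b * slope a) (a * slope b) = rearrangement-ordered b≤a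

-- For `1 ≤ d ≤ 4` this is the recurrence defining `f`, an equality, with `f (d - 1) - f d` written
-- as the slope to avoid subtraction. The scale 850 is the least common denominator of `f 1`, ...,
-- `f 4`, which are 1/2, 2/5, 17/50 and 127/425.
weight-balance : ∀ d → weight d + d * slope d + d * weight d ≤ 850 + d * (d * slope d)
weight-balance d with d ℕ.<? 5
... | yes d<5 = from-yes (ℕ.allUpTo? balance? 5) {d} d<5
... | no d≮5 rewrite 5≤⇒weight≡0 (ℕ.≮⇒≥ d≮5) | 5≤⇒slope≡0 (ℕ.≮⇒≥ d≮5) | ℕ.*-zeroʳ d = z≤n

module _ (G : Graph n) where
  open Graph G

  module _ (P : Subsetᵇ n) where

    adj : Fin n → Fin n → Bool
    adj u v = P u ∧ (P v ∧ does (u ~? v))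

    deg : Fin n → ℕ
    deg u = count (adj u)

    totalWeight : ℕ
    totalWeight = ∑ λ u → ind (P u) * weight (deg u)

    adj⁻ : ∀ {u v} → adj u v ≡ true → P u ≡ true × P v ≡ true × u ~ v
    adj⁻ {u} {v} a =
      let pu , b = ∧⁻ a
          pv , c = ∧⁻ b
      in pu , pv , does⁻ (u ~? v) c

    adj⁺ : ∀ {u v} → P u ≡ true → P v ≡ true → u ~ v → adj u v ≡ true
    adj⁺ {u} {v} pu pv u~v = ∧⁺ pu (∧⁺ pv (dec-true (u ~? v) u~v))

    adj-sym : ∀ u v → adj u v ≡ adj v u
    adj-sym u v = bool-ext swap swap
      where
      swap : ∀ {u v} → adj u v ≡ true → adj v u ≡ true
      swap a = let pu , pv , u~v = adj⁻ a in adj⁺ pv pu (~-sym u~v)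

    star : Fin n → Subsetᵇ n
    star v u = ⁅ v ⁆ u ∨ adj v u

    removeStar : Fin n → Subsetᵇ n
    removeStar v = P ∖ star v

    removeStar⁻ : ∀ {u v} → removeStar v u ≡ true → P u ≡ true × u ≢ v × ¬ adj v u ≡ true
    removeStar⁻ {u} {v} r =
      let p , q = ∖⁻ {P = P} {star v} u r
          u∉ , ¬vu = ∨-not {⁅ v ⁆ u} q
      in p , (λ { refl → u∉ (⁅⁆⁺ u) }) , ¬vu
      where
      ∨-not : ∀ {a b} → ¬ (a ∨ b) ≡ true → ¬ a ≡ true × ¬ b ≡ true
      ∨-not {true}  q = contradiction refl q
      ∨-not {false} q = (λ ()) , q

    removeStar⁺ : ∀ {u v} → P u ≡ true → u ≢ v → ¬ adj v u ≡ true → removeStar v u ≡ true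
    removeStar⁺ {u} {v} p u≢v q =
      ∖⁺ {P = P} {star v} p (subst (λ b → ¬ b ∨ adj v u ≡ true) (sym (⁅⁆-false u≢v)) q)

    commonNeighbours : Fin n → Fin n → ℕ
    commonNeighbours v u = ∑ λ w → ind (adj u w) * ind (adj w v)

    -- A walk u - w - v with u outside the star of v records a neighbour w that u loses when the
    -- star is deleted, worth at least `slope (deg u)` to the weight of u. Walks returning to v
    -- contribute `deg v * slope (deg v)`, which is charged to the centre.
    walks : Fin n → ℕ
    walks v = ∑ λ u → commonNeighbours v u * slope (deg u)

module _ (G : Graph n) (triangle-free : TriangleFree G) where
  open Graph G

  module _ (P : Subsetᵇ n) where
    private
      E : Fin n → Fin n → ℕ
      E u v = ind (adj G P u v)

      d : Fin n → ℕ
      d = deg G P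

      c : Fin n → Fin n → ℕ
      c = commonNeighbours G P

      p : Fin n → ℕ
      p = ind ∘ P

      no-edge : ∀ {u v} → (P u ≡ true → P v ≡ true → ¬ u ~ v) → E u v ≡ 0
      no-edge {u} {v} h = cong ind (≢true λ a → let pu , pv , u~v = adj⁻ G P a in h pu pv u~v)

      outside-deg : ∀ {u} → P u ≡ false → d u ≡ 0
      outside-deg ¬pu = ∑-0 λ w → no-edge λ pu → contradiction pu (false≢true ¬pu)

      outside-common : ∀ {u v} → P u ≡ false → c v u ≡ 0
      outside-common {v = v} ¬pu = ∑-0 λ w →
        cong (_* E w v) (no-edge λ pu → contradiction pu (false≢true ¬pu))

      adjacent-common : ∀ {u v} → u ~ v → c v u ≡ 0
      adjacent-common {u} {v} u~v = ∑-0 λ w → lemma w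
        where
        lemma : ∀ w → E u w * E w v ≡ 0
        lemma w with adj G P u w in uw
        ... | false = refl
        ... | true  = trans (ℕ.*-identityˡ (E w v)) (no-edge λ _ _ w~v →
          triangle-free (~-sym u~v) (proj₂ (proj₂ (adj⁻ G P uw))) w~v)

      self-common : ∀ v → c v v ≡ d v
      self-common v = ∑-cong λ w → trans
        (cong (λ b → E v w * ind b) (adj-sym G P w v)) (ind-idem (adj G P v w))
        where
        ind-idem : ∀ b → ind b * ind b ≡ ind b
        ind-idem true  = refl
        ind-idem false = refl

      -- The common neighbours of `u` and `v` disappear with the star of `v`.
      deg-removeStar : ∀ {u v} → deg G (removeStar G P v) u + c v u ≤ d u
      deg-removeStar {u} {v} = subst (_≤ d u) (∑-+ _ _) (∑-mono pointwise)
        where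
        pointwise : ∀ w → ind (adj G (removeStar G P v) u w) + E u w * E w v ≤ E u w
        pointwise w with adj G (removeStar G P v) u w in eq
        ... | false = ℕ.≤-trans (ℕ.*-monoʳ-≤ (E u w) (ind-mono {adj G P w v} {true} λ _ → refl))
          (ℕ.≤-reflexive (ℕ.*-identityʳ (E u w)))
        ... | true
          with ru , rw , u~w ← adj⁻ G (removeStar G P v) eq
          with pu , _ ← removeStar⁻ G P ru
          with pw , _ , ¬vw ← removeStar⁻ G P rw
          = no-path (cong ind (adj⁺ G P pu pw u~w))
              (cong ind (trans (adj-sym G P w v) (≢true ¬vw)))
          where
          no-path : ∀ {x y} → x ≡ 1 → y ≡ 0 → 1 + x * y ≤ x
          no-path refl refl = ℕ.≤-refl

      -- For a neighbour of `v` the walk term vanishes, since a common neighbour would close a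
      -- triangle. At the centre it is `d v * slope (d v)`. For every other vertex of `P`, convexity
      -- lets the gain in weight pay for it.
      star-pointwise : ∀ {v} → P v ≡ true → ∀ u →
        p u * weight (d u) + c v u * slope (d u) ≤
        ind (removeStar G P v u) * weight (deg G (removeStar G P v) u)
        + (ind (⁅ v ⁆ u) * (weight (d u) + d u * slope (d u)) + E v u * weight (d u))
      star-pointwise {v} pv u = cases (P u ≟ᵇ true) (u ≟ v) (adj G P v u ≟ᵇ true)
        where
        x : ℕ
        x = ind (removeStar G P v u) * weight (deg G (removeStar G P v) u)

        outside : ∀ {p c w s r} → p ≡ 0 → c ≡ 0 → p * w + c * s ≤ r
        outside refl refl = z≤n

        at-centre : ∀ {p c d e w s x y} → p ≡ 1 → c ≡ d → e ≡ 1 →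
                    p * w + c * s ≤ x + (e * (w + d * s) + y)
        at-centre {c = c} {w = w} {s} {x} {y} refl refl refl
          rewrite ℕ.*-identityˡ w | ℕ.*-identityˡ (w + c * s) =
          ℕ.≤-trans (ℕ.m≤m+n _ y) (ℕ.m≤n+m _ x)

        at-neighbour : ∀ {p c e w s x y} → p ≡ 1 → c ≡ 0 → e ≡ 1 →
                       p * w + c * s ≤ x + (y + e * w)
        at-neighbour {w = w} {x = x} {y} refl refl refl rewrite ℕ.+-identityʳ (1 * w) =
          ℕ.≤-trans (ℕ.m≤n+m _ y) (ℕ.m≤n+m _ x)

        far : ∀ {p p′ c w w′ s x} → p ≡ 1 → p′ ≡ 1 → w + c * s ≤ w′ →
              p * w + c * s ≤ p′ * w′ + x
        far {w = w} {w′} refl refl le rewrite ℕ.*-identityˡ w | ℕ.*-identityˡ w′ =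
          ℕ.≤-trans le (ℕ.m≤m+n _ _)

        cases : Dec (P u ≡ true) → Dec (u ≡ v) → Dec (adj G P v u ≡ true) →
          p u * weight (d u) + c v u * slope (d u) ≤
          ind (removeStar G P v u) * weight (deg G (removeStar G P v) u)
          + (ind (⁅ v ⁆ u) * (weight (d u) + d u * slope (d u)) + E v u * weight (d u))
        cases (no ¬pu) _ _ = outside {c = c v u} (cong ind (≢true ¬pu)) (outside-common (≢true ¬pu))
        cases (yes pu) (yes refl) _ =
          at-centre {x = x} {E u u * weight (d u)} (cong ind pu) (self-common u) (cong ind (⁅⁆⁺ u))
        cases (yes pu) (no _) (yes vu) = at-neighbour
          {x = x} {ind (⁅ v ⁆ u) * (weight (d u) + d u * slope (d u))} (cong ind pu)
          (adjacent-common (~-sym (proj₂ (proj₂ (adj⁻ G P vu))))) (cong ind vu)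
        cases (yes pu) (no u≢v) (no ¬vu) =
          far {c = c v u} {s = slope (d u)} (cong ind pu) (cong ind (removeStar⁺ G P pu u≢v ¬vu))
            (weight-convex (d u) (c v u) _ deg-removeStar)

      Φ : ℕ
      Φ = totalWeight G P

      Φ′ : Fin n → ℕ
      Φ′ v = totalWeight G (removeStar G P v)

      star-sum : ∀ v → p v * Φ + walks G P v ≤
        p v * Φ′ v + (p v * (weight (d v) + d v * slope (d v)) + ∑ λ u → E v u * weight (d u))
      star-sum v with P v ≟ᵇ true
      ... | no ¬pv = vanishing (cong ind (≢true ¬pv)) (∑-0 λ u →
        cong (_* slope (d u)) (∑-0 λ w → trans
          (cong (E u w *_) (no-edge λ _ pv → contradiction pv ¬pv)) (ℕ.*-zeroʳ (E u w))))
        where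
        vanishing : ∀ {p x y z} → p ≡ 0 → x ≡ 0 → p * y + x ≤ z
        vanishing refl refl = z≤n
      ... | yes pv = present (cong ind pv) (begin
        Φ + walks G P v
          ≡⟨ ∑-+ _ _ ⟨
        ∑ (λ u → p u * weight (d u) + c v u * slope (d u))
          ≤⟨ ∑-mono (star-pointwise pv) ⟩
        ∑ (λ u → p′ u + (q u + r u))
          ≡⟨ trans (∑-+ p′ _) (cong (Φ′ v +_) (trans (∑-+ q r) (cong (_+ ∑ r)
               (∑-⁅⁆ v (λ u → weight (d u) + d u * slope (d u)))))) ⟩
        Φ′ v + (weight (d v) + d v * slope (d v) + ∑ r) ∎)
        where
        present : ∀ {p w x y z t} → p ≡ 1 → w + x ≤ y + (z + t) →
                  p * w + x ≤ p * y + (p * z + t)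
        present {w = w} {y = y} {z} refl le
          rewrite ℕ.*-identityˡ w | ℕ.*-identityˡ y | ℕ.*-identityˡ z = le
        open ℕ.≤-Reasoning
        p′ q r : Fin n → ℕ
        p′ u = ind (removeStar G P v u) * weight (deg G (removeStar G P v) u)
        q u = ind (⁅ v ⁆ u) * (weight (d u) + d u * slope (d u))
        r u = E v u * weight (d u)

      E-sym : ∀ u v → E u v ≡ E v u
      E-sym u v = cong ind (adj-sym G P u v)

      neighbour-weights : ∑ (λ v → ∑ λ u → E v u * weight (d u)) ≡ ∑ (λ u → d u * weight (d u))
      neighbour-weights = trans (∑-comm _) (∑-cong λ u →
        trans (∑-cong λ v → cong (_* weight (d u)) (E-sym v u)) (sym (∑-* (E u) _)))

      squares : ℕ
      squares = ∑ λ u → d u * (d u * slope (d u))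

      cross : ℕ
      cross = ∑ λ u → ∑ λ w → E u w * (d w * slope (d u))

      walks≡cross : ∑ (walks G P) ≡ cross
      walks≡cross = trans (∑-comm _) (∑-cong λ u → begin
        ∑ (λ v → c v u * slope (d u))                    ≡⟨ ∑-* (λ v → c v u) _ ⟨
        ∑ (λ v → ∑ λ w → E u w * E w v) * slope (d u)     ≡⟨ cong (_* slope (d u)) (∑-comm _) ⟩
        ∑ (λ w → ∑ λ v → E u w * E w v) * slope (d u)
          ≡⟨ cong (_* slope (d u)) (∑-cong λ w → sym (*-∑ (E u w) (E w))) ⟩
        ∑ (λ w → E u w * d w) * slope (d u)              ≡⟨ ∑-* _ _ ⟩
        ∑ (λ w → E u w * d w * slope (d u))
          ≡⟨ ∑-cong (λ w → ℕ.*-assoc (E u w) (d w) _) ⟩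
        ∑ (λ w → E u w * (d w * slope (d u)))            ∎)
        where open ≡-Reasoning

      -- Both are sums over ordered edges (u, w), of `d u * slope (d u)` and of `d w * slope (d u)`.
      -- Doubling allows u and w to be swapped in one copy, after which the rearrangement inequality
      -- applies edge by edge. In `average` the walk sum, being `cross`, thereby absorbs the squares
      -- that `balance` leaves over.
      squares≤cross : squares ≤ cross
      squares≤cross = ℕ.*-cancelˡ-≤ 2 (begin
        2 * squares
          ≡⟨ cong (squares +_) (ℕ.+-identityʳ squares) ⟩
        squares + squares
          ≡⟨ cong₂ _+_ squares≡ (trans squares≡ (∑-comm _)) ⟩
        ∑ (λ u → ∑ (s u)) + ∑ (λ u → ∑ λ w → s w u)
          ≡⟨ trans (∑-cong λ u → ∑-+ (s u) λ w → s w u) (∑-+ _ _) ⟨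
        ∑ (λ u → ∑ λ w → s u w + s w u)
          ≤⟨ ∑-mono (λ u → ∑-mono (pointwise u)) ⟩
        ∑ (λ u → ∑ λ w → t u w + t w u)
          ≡⟨ trans (∑-cong λ u → ∑-+ (t u) λ w → t w u) (∑-+ _ _) ⟩
        cross + ∑ (λ u → ∑ λ w → t w u)
          ≡⟨ cong (cross +_) (trans (∑-comm (λ u w → t w u)) (sym (ℕ.+-identityʳ cross))) ⟩
        2 * cross ∎)
        where
        open ℕ.≤-Reasoning
        s t : Fin n → Fin n → ℕ
        s u w = E u w * (d u * slope (d u))
        t u w = E u w * (d w * slope (d u))

        squares≡ : squares ≡ ∑ (λ u → ∑ (s u))
        squares≡ = ∑-cong λ u → ∑-* (E u) _

        pointwise : ∀ u w → s u w + s w u ≤ t u w + t w u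
        pointwise u w rewrite E-sym w u
          | sym (ℕ.*-distribˡ-+ (E u w) (d u * slope (d u)) (d w * slope (d w)))
          | sym (ℕ.*-distribˡ-+ (E u w) (d w * slope (d u)) (d u * slope (d w))) =
          ℕ.*-monoʳ-≤ (E u w) (slope-rearrangement (d u) (d w))

      balance : ∀ v → p v * (weight (d v) + d v * slope (d v)) + d v * weight (d v) ≤
                p v * 850 + d v * (d v * slope (d v))
      balance v with P v ≟ᵇ true
      ... | no ¬pv = vanishing (cong ind (≢true ¬pv)) (outside-deg (≢true ¬pv))
        where
        vanishing : ∀ {p d x y z} → p ≡ 0 → d ≡ 0 → p * x + d * y ≤ z
        vanishing refl refl = z≤n
      ... | yes pv = present (cong ind pv) (weight-balance (d v))
        where
        present : ∀ {p x y z} → p ≡ 1 → x + y ≤ 850 + z → p * x + y ≤ p * 850 + z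
        present {x = x} refl le rewrite ℕ.*-identityˡ x = le

      -- Averaged over v, deleting the closed neighbourhood of v costs at most 850 in weight.
      average : ∑ (λ v → p v * Φ) ≤ ∑ (λ v → p v * (Φ′ v + 850))
      average = ℕ.+-cancelʳ-≤ (∑ (walks G P)) _ _ (begin
        ∑ (λ v → p v * Φ) + ∑ (walks G P)
          ≡⟨ ∑-+ _ _ ⟨
        ∑ (λ v → p v * Φ + walks G P v)
          ≤⟨ ∑-mono star-sum ⟩
        ∑ (λ v → a v + (k v + x v))
          ≡⟨ trans (∑-+ a _) (cong (∑ a +_) (∑-+ k x)) ⟩
        ∑ a + (∑ k + ∑ x)
          ≡⟨ cong (λ y → ∑ a + (∑ k + y)) neighbour-weights ⟩
        ∑ a + (∑ k + ∑ (λ v → d v * weight (d v)))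
          ≡⟨ cong (∑ a +_) (∑-+ _ _) ⟨
        ∑ a + ∑ (λ v → k v + d v * weight (d v))
          ≤⟨ ℕ.+-monoʳ-≤ (∑ a) (∑-mono balance) ⟩
        ∑ a + ∑ (λ v → p v * 850 + d v * (d v * slope (d v)))
          ≡⟨ trans (cong (∑ a +_) (∑-+ b _)) (sym (ℕ.+-assoc (∑ a) (∑ b) squares)) ⟩
        ∑ a + ∑ b + squares
          ≤⟨ ℕ.+-monoʳ-≤ (∑ a + ∑ b) squares≤cross ⟩
        ∑ a + ∑ b + cross
          ≡⟨ cong₂ _+_
               (trans (sym (∑-+ a b)) (∑-cong λ v → sym (ℕ.*-distribˡ-+ (p v) (Φ′ v) 850)))
               (sym walks≡cross) ⟩
        ∑ (λ v → p v * (Φ′ v + 850)) + ∑ (walks G P) ∎)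
        where
        open ℕ.≤-Reasoning
        a b k x : Fin n → ℕ
        a v = p v * Φ′ v
        b v = p v * 850
        k v = p v * (weight (d v) + d v * slope (d v))
        x v = ∑ λ u → E v u * weight (d u)

    -- Pigeonhole on `average`; the given vertex makes the contradicting sum strict.
    good-star : ∀ {v} → P v ≡ true →
                ∃[ v ] (P v ≡ true × Φ ≤ Φ′ v + 850)
    good-star {v₀} pv₀ with any? (λ v → (P v ≟ᵇ true) ×-dec (Φ ℕ.≤? Φ′ v + 850))
    ... | yes found = found
    ... | no ∄ = contradiction average (ℕ.<⇒≱ (∑-mono-< weakly v₀
        (subst (λ b → ind b * (Φ′ v₀ + 850) < ind b * Φ) (sym pv₀)
          (ℕ.*-monoʳ-< 1 (strict pv₀)))))
      where
      strict : ∀ {v} → P v ≡ true → Φ′ v + 850 < Φ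
      strict {v} pv = ℕ.≰⇒> λ Φ≤ → ∄ (v , pv , Φ≤)

      weakly : ∀ v → p v * (Φ′ v + 850) ≤ p v * Φ
      weakly v with P v ≟ᵇ true
      ... | yes pv = ℕ.*-monoʳ-≤ (p v) (ℕ.<⇒≤ (strict pv))
      ... | no ¬pv rewrite ≢true ¬pv = z≤n

  -- Greedy choice: the centre of a good star joins the independent set and its star is deleted. The
  -- weight drops by at most 850, the scaled value of the one vertex gained.
  weighted-independent : ∀ k P → count P ≤ k →
    ∃[ T ] (T ⊆ P × Indep G T × totalWeight G P ≤ count T * 850)
  weighted-independent k P size≤k with empty⊎member P
  ... | inj₁ size≡0 =
    (λ _ → false) , (λ _ ()) , (λ _ _ ()) ,
    ℕ.≤-trans (ℕ.≤-reflexive (∑-0 λ v → cong (_* weight (deg G P v)) (cong ind (≢true (none v))))) z≤n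
    where
    none : ∀ v → ¬ P v ≡ true
    none v v∈ = contradiction (subst (1 ≤_) size≡0 (count-pos v∈)) λ ()
  weighted-independent zero P size≤k | inj₂ (_ , v∈) =
    contradiction (ℕ.≤-trans (count-pos v∈) size≤k) λ ()
  weighted-independent (suc k) P size≤k | inj₂ (_ , v∈)
    with v , pv , Φ≤ ← good-star P v∈
    with T , T⊆ , T-indep , bound ← weighted-independent k (removeStar G P v)
      (s≤s⁻¹ (ℕ.≤-trans (s≤s (count-mono λ u r → let pu , u≢v , _ = removeStar⁻ G P r
        in ∖⁺ {P = P} {⁅ v ⁆} pu (u≢v ∘ ⁅⁆⁻))) (subst (_≤ suc k) (count-remove pv) size≤k))) =
    T′ , T′⊆P , T′-indep , (begin
      totalWeight G P                          ≤⟨ Φ≤ ⟩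
      totalWeight G (removeStar G P v) + 850   ≤⟨ ℕ.+-monoˡ-≤ 850 bound ⟩
      count T * 850 + 850                      ≡⟨ ℕ.+-comm _ 850 ⟩
      suc (count T) * 850
        ≡⟨ cong (λ k → k * 850) {count T′} {suc (count T)} count-T′ ⟨
      count T′ * 850                           ∎)
    where
    open ℕ.≤-Reasoning
    T′ : Subsetᵇ n
    T′ = insert v T

    T⁻ : ∀ {u} → T u ≡ true → P u ≡ true × u ≢ v × ¬ adj G P v u ≡ true
    T⁻ t = removeStar⁻ G P (T⊆ _ t)

    T′⊆P : T′ ⊆ P
    T′⊆P u t with insert⁻ {v = v} {T} t
    ... | inj₁ refl = pv
    ... | inj₂ t    = proj₁ (T⁻ t)

    T′-indep : Indep G T′
    T′-indep = insert-indep {G = G} T-indep λ u tu v~u →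
      let pu , _ , ¬vu = T⁻ tu in ¬vu (adj⁺ G P pv pu v~u)

    count-T′ : count T′ ≡ suc (count T)
    count-T′ = count-insert λ tv → proj₁ (proj₂ (T⁻ tv)) refl

-- Maximum matchings of vertex subsets and Gallai's lemma.

module _ {G : Graph n} where

  restrict : ∀ {P Q} (M : Mate G P) → (∀ v → mate M v ≢ v → Q v ≡ true) → Mate G Q
  restrict M in-Q = record
    { mate = mate M ; involutive = involutive M ; edge = edge M ; inside = in-Q }

module _ (G : Graph n) where
  open Graph G

  private
    present : ∀ P → Presents (G [ tabulate P ]) G P
    present P = presents-induced G (tabulate P) (lookup∘tabulate P)

  opaque
    -- `α` and `β` are exhaustive searches. Sealed here, they are known only through attainment and
    -- maximality.
    αₛ βₛ : Subsetᵇ n → ℕ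
    αₛ P = α (G [ tabulate P ])
    βₛ P = β (G [ tabulate P ])

    αₛ-attained : ∀ P → IndepIn G P (αₛ P)
    αₛ-attained P = α-attained (present P)

    αₛ-maximal : ∀ P {k} → IndepIn G P k → k ≤ αₛ P
    αₛ-maximal P = α-maximal (present P)

    βₛ-attained : ∀ P → Σ[ M ∈ Mate G P ] size M ≡ βₛ P * 2
    βₛ-attained P = β-attained (present P)

    βₛ-maximal : ∀ P (M : Mate G P) → size M ≤ βₛ P * 2
    βₛ-maximal P = β-maximal (present P)

  module _ {P : Subsetᵇ n} where

    Maximum : Mate G P → Set
    Maximum M = size M ≡ βₛ P * 2

    size≤ : (M : Mate G P) → size M ≤ βₛ P * 2
    size≤ = βₛ-maximal P

    infix 4 _⋈_

    -- Not reflexive as it stands: `u ⋈ u` says that every maximum matching covers `u`. The class of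
    -- `t` is therefore written `w ≡ t ⊎ t ⋈ w`, and transitivity is stated for distinct ends.
    _⋈_ : Fin n → Fin n → Set
    u ⋈ v = (M : Mate G P) → Maximum M → mate M u ≡ u → ¬ mate M v ≡ v

    -- Linking two missed neighbours would enlarge a maximum matching.
    adjacent⇒⋈ : ∀ {u v} → P u ≡ true → P v ≡ true → u ~ v → u ⋈ v
    adjacent⇒⋈ pu pv u~v M max u-free v-free = ℕ.m+1+n≰m (βₛ P * 2)
      (subst (_≤ βₛ P * 2) (trans (size-link M u~v pu pv u-free v-free) (cong (_+ 2) max))
        (size≤ (link M u~v pu pv u-free v-free)))

    -- The measure raised by each exchange in Gallai's argument; it is at most `n`, which ends the
    -- search.
    agreement : Mate G P → Mate G P → ℕ
    agreement M N = count λ w → does (mate M w ≟ mate N w)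

    module _ {u v t : Fin n} (u≢v : u ≢ v) (t⋈u : t ⋈ u) (t⋈v : t ⋈ v)
             (M : Mate G P) (M-max : Maximum M)
             (u-free : mate M u ≡ u) (v-free : mate M v ≡ v) where
      private
        module _ (N : Mate G P) (N-max : Maximum N) (t-free : mate N t ≡ t) where

          Exchange : Fin n → Set
          Exchange x = x ≢ t × mate M x ≢ x × mate N x ≡ x

          exchange? : ∀ x → Dec (Exchange x)
          exchange? x = ¬? (x ≟ t) ×-dec (¬? (mate M x ≟ x) ×-dec (mate N x ≟ x))

          -- N covers u and v, M does not, and both have the same size.
          exchange : ∃[ x ] Exchange x
          exchange with any? exchange?
          ... | yes found = found
          ... | no ∄ = contradiction
            (subst₂ _≤_ (∑-pair (ind ∘ moves (mate M)) u v)
              (trans (∑-+ (ind ∘ moves (mate N)) _) (cong (size N +_) (count-⁅⁆ t)))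
              (∑-mono pointwise))
            λ le → ℕ.1+n≰n (ℕ.+-cancelˡ-≤ (βₛ P * 2) 2 1
              (subst₂ (λ x y → x + 2 ≤ y + 1) M-max N-max le))
            where
            pointwise : ∀ w → ind (moves (mate M) w) + (ind (⁅ u ⁆ w) + ind (⁅ v ⁆ w)) ≤
                        ind (moves (mate N) w) + ind (⁅ t ⁆ w)
            pointwise w = cases (w ≟ u) (w ≟ v) (w ≟ t) (mate M w ≟ w)
              where
              old e f new g : ℕ
              old = ind (moves (mate M) w)
              e = ind (⁅ u ⁆ w)
              f = ind (⁅ v ⁆ w)
              new = ind (moves (mate N) w)
              g = ind (⁅ t ⁆ w)

              gained : ∀ {old e f new} → old ≡ 0 → e + f ≡ 1 → new ≡ 1 → old + (e + f) ≤ new + g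
              gained refl eq refl rewrite eq = s≤s z≤n

              bounded : e ≡ 0 → f ≡ 0 → old ≤ new + g → old + (e + f) ≤ new + g
              bounded e≡0 f≡0 le rewrite e≡0 | f≡0 | ℕ.+-identityʳ old = le

              moved : ∀ {x} → t ⋈ x → ind (moves (mate N) x) ≡ 1
              moved {x} t⋈x = cong ind (moves⁺ {f = mate N} {x} (t⋈x N N-max t-free))

              cases : Dec (w ≡ u) → Dec (w ≡ v) → Dec (w ≡ t) → Dec (mate M w ≡ w) →
                      old + (e + f) ≤ new + g
              cases (yes refl) _ _ _ = gained {old} {e} {f} (cong ind (fixes {f = mate M} {w} u-free))
                (cong₂ (λ x y → ind x + ind y) (⁅⁆⁺ w) (⁅⁆-false u≢v)) (moved t⋈u)
              cases (no w≢u) (yes refl) _ _ =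
                gained {old} {e} {f} (cong ind (fixes {f = mate M} {w} v-free))
                (cong₂ (λ x y → ind x + ind y) (⁅⁆-false w≢u) (⁅⁆⁺ w)) (moved t⋈v)
              cases (no w≢u) (no w≢v) w≟t M-free? =
                bounded (cong ind (⁅⁆-false w≢u)) (cong ind (⁅⁆-false w≢v)) (rest w≟t M-free?)
                where
                rest : Dec (w ≡ t) → Dec (mate M w ≡ w) → old ≤ new + g
                rest _ (yes free) =
                  ℕ.≤-trans (ℕ.≤-reflexive (cong ind (fixes {f = mate M} {w} free))) z≤n
                rest (yes refl) _ = ℕ.≤-trans
                  (ind-mono {moves (mate M) w} {⁅ t ⁆ w} λ _ → ⁅⁆⁺ w) (ℕ.m≤n+m g new)
                rest (no w≢t) (no M-moved) = ℕ.≤-trans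
                  (ind-mono {moves (mate M) w} {moves (mate N) w}
                    λ _ → moves⁺ {f = mate N} {w} λ N-free → ∄ (w , w≢t , M-moved , N-free))
                  (ℕ.m≤m+n new g)

          -- The vertex `x` from `exchange` is missed by `N`, so its `M`-mate `y` is covered by `N`,
          -- or `N` could be enlarged. Trading the `N`-edge at `y` for the `M`-edge xy preserves the
          -- size and still misses `t`.
          improve : Σ[ N′ ∈ Mate G P ]
            (Maximum N′ × mate N′ t ≡ t × agreement M N < agreement M N′)
          improve
            with x , x≢t , M-moved , N-free ← exchange
            with mate N (mate M x) ≟ mate M x
          ... | yes y-free = contradiction y-free (adjacent⇒⋈ (inside M x M-moved)
            (inside M (mate M x) (mate-moved M M-moved)) (edge M x M-moved) N N-max N-free)
          ... | no y-moved = N′ , N′-max , N′-free , ∑-mono-< agree x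
                (subst₂ (λ p q → ind p < ind q)
                  (sym (dec-false (mate M x ≟ mate N x) λ eq → M-moved (trans eq N-free)))
                  (sym (dec-true (mate M x ≟ mate N′ x) (sym (update-fst (mate U)))))
                  (s≤s z≤n))
            where
            y = mate M x
            U = unlink N y-moved

            U-free : mate U x ≡ x
            U-free = unlink-fixed N y-moved N-free

            x~y = edge M x M-moved
            px = inside M x M-moved
            py = inside M y (mate-moved M M-moved)
            N′ = link U x~y px py U-free (unlink-fst N y-moved)

            N′-max : Maximum N′
            N′-max = trans (size-link U x~y px py U-free (unlink-fst N y-moved))
              (trans (sym (size-unlink N y-moved)) N-max)

            N′-free : mate N′ t ≡ t
            N′-free = trans
              (update-other (mate U) (≢-sym x≢t)
                (λ t≡y → y-moved (subst (λ z → mate N z ≡ z) t≡y t-free)))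
              (unlink-fixed N y-moved t-free)

            keep : ∀ w → mate M w ≡ mate N w → mate M w ≡ mate N′ w
            keep = update-elim (mate U) (λ w z → mate M w ≡ mate N w → mate M w ≡ z)
              (λ _ → refl)
              (λ _ _ → involutive M x)
              λ w w≢x w≢y → update-elim (mate N)
                (λ w z → w ≢ x → w ≢ y → mate M w ≡ mate N w → mate M w ≡ z)
                (λ _ w≢y _ → contradiction refl w≢y)
                -- No agreement is lost at the old partner `w` of `y`: if `M` also matched `w` to
                -- `y`, then `w` would be `x`.
                (λ _ w≢x _ eq → contradiction
                  (mate-injective M (trans eq (involutive N y))) w≢x)
                (λ _ _ _ _ _ eq → eq) w w≢x w≢y

            agree : ∀ w → ind (does (mate M w ≟ mate N w)) ≤ ind (does (mate M w ≟ mate N′ w))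
            agree w = ind-mono λ eq → dec-true (mate M w ≟ mate N′ w) (keep w (does⁻ (_ ≟ _) eq))

        search : ∀ k (N : Mate G P) → Maximum N → mate N t ≡ t → ¬ n < agreement M N + k
        search zero N _ _ n< = ℕ.<⇒≱ n< (subst (_≤ n) (sym (ℕ.+-identityʳ _))
          (count≤n λ w → does (mate M w ≟ mate N w)))
        search (suc k) N N-max t-free n<
          with N′ , N′-max , t-free′ , more ← improve N N-max t-free =
          search k N′ N′-max t-free′ (ℕ.<-≤-trans n<
            (subst (_≤ agreement M N′ + k) (sym (ℕ.+-suc (agreement M N) k))
              (ℕ.+-monoˡ-≤ k more)))

      -- Gallai: among the maximum matchings missing t, one sharing the most
      -- edges with M could still be improved by an exchange.
      no-maximum-missing : (N : Mate G P) → Maximum N → ¬ mate N t ≡ t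
      no-maximum-missing N N-max t-free =
        search (suc n) N N-max t-free (ℕ.m≤n+m (suc n) _)

-- Additivity of α and β over vertex sets that no edge leaves.

module _ (G : Graph n) where
  open Graph G

  -- For `Q ⊆ P` this makes `Q` a union of connected components of the graph on `P`.
  Closed : Subsetᵇ n → Subsetᵇ n → Set
  Closed P Q = ∀ {u w} → Q u ≡ true → P w ≡ true → u ~ w → Q w ≡ true

module _ {G : Graph n} where
  open Graph G

  Closed-∖ : ∀ {P Q} → Closed G P Q → Q ⊆ P → Closed G P (P ∖ Q)
  Closed-∖ {P} {Q} closed Q⊆P {u} u∈ pw u~w =
    let pu , ¬qu = ∖⁻ {P = P} {Q} u u∈
    in ∖⁺ {P = P} {Q} pw λ qw → ¬qu (closed qw pu (~-sym u~w))

  αₛ-mono : ∀ {P Q} → P ⊆ Q → αₛ G P ≤ αₛ G Q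
  αₛ-mono {P} {Q} P⊆Q with T , T⊆P , T-indep , size ← αₛ-attained G P =
    αₛ-maximal G Q (T , (λ v t → P⊆Q v (T⊆P v t)) , T-indep , size)

  module _ {P Q : Subsetᵇ n} (Q⊆P : Q ⊆ P) where

    αₛ-subadditive : αₛ G P ≤ αₛ G Q + αₛ G (P ∖ Q)
    αₛ-subadditive with T , T⊆P , T-indep , size ← αₛ-attained G P =
      subst₂ _≤_ (trans (sym (count-∖ {P = T} {T∩Q} λ v → proj₁ ∘ ∧⁻)) size) refl
        (ℕ.+-mono-≤
          (αₛ-maximal G Q
            ( T∩Q
            , (λ v → proj₂ ∘ ∧⁻ {T v})
            , (λ u v tu tv → T-indep u v (proj₁ (∧⁻ tu)) (proj₁ (∧⁻ tv)))
            , refl))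
          (αₛ-maximal G (P ∖ Q)
            ( T ∖ T∩Q
            , (λ v t → let tv , ¬tq = ∖⁻ {P = T} {T∩Q} v t
                in ∖⁺ {P = P} {Q} (T⊆P v tv) (¬tq ∘ ∧⁺ tv))
            , (λ u v tu tv → T-indep u v (∖-⊆ {P = T} {T∩Q} u tu) (∖-⊆ {P = T} {T∩Q} v tv))
            , refl)))
      where
      T∩Q : Subsetᵇ n
      T∩Q v = T v ∧ Q v

    -- The union of independent sets from the two parts is independent because no edge joins the
    -- parts.
    αₛ-superadditive : Closed G P Q → αₛ G Q + αₛ G (P ∖ Q) ≤ αₛ G P
    αₛ-superadditive closed
      with S , S⊆ , S-indep , S-size ← αₛ-attained G Q
      with T , T⊆ , T-indep , T-size ← αₛ-attained G (P ∖ Q) =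
      αₛ-maximal G P (S∪T , S∪T⊆P , indep , trans count-∪ (cong₂ _+_ S-size T-size))
      where
      S∪T : Subsetᵇ n
      S∪T v = S v ∨ T v

      ∨⁻ : ∀ {a b} → a ∨ b ≡ true → a ≡ true ⊎ b ≡ true
      ∨⁻ {true}  _ = inj₁ refl
      ∨⁻ {false} b = inj₂ b

      T⁻ : ∀ {v} → T v ≡ true → P v ≡ true × ¬ Q v ≡ true
      T⁻ {v} t = ∖⁻ {P = P} {Q} v (T⊆ v t)

      S∪T⊆P : S∪T ⊆ P
      S∪T⊆P v v∈ with ∨⁻ {S v} v∈
      ... | inj₁ s = Q⊆P v (S⊆ v s)
      ... | inj₂ t = proj₁ (T⁻ t)

      indep : Indep G S∪T
      indep u v u∈ v∈ u~v with ∨⁻ {S u} u∈ | ∨⁻ {S v} v∈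
      ... | inj₁ su | inj₁ sv = S-indep u v su sv u~v
      ... | inj₂ tu | inj₂ tv = T-indep u v tu tv u~v
      ... | inj₁ su | inj₂ tv = proj₂ (T⁻ tv) (closed (S⊆ u su) (proj₁ (T⁻ tv)) u~v)
      ... | inj₂ tu | inj₁ sv = proj₂ (T⁻ tu) (closed (S⊆ v sv) (proj₁ (T⁻ tu)) (~-sym u~v))

      count-∪ : count S∪T ≡ count S + count T
      count-∪ = trans (∑-cong λ v → pointwise λ s t → proj₂ (T⁻ t) (S⊆ v s)) (∑-+ _ _)
        where
        pointwise : ∀ {s t} → (s ≡ true → ¬ t ≡ true) → ind (s ∨ t) ≡ ind s + ind t
        pointwise {false}        _    = refl
        pointwise {true} {false} _    = refl
        pointwise {true} {true}  disj = contradiction refl (disj refl)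

    βₛ-superadditive : βₛ G Q + βₛ G (P ∖ Q) ≤ βₛ G P
    βₛ-superadditive
      with M , M-size ← βₛ-attained G Q
      with N , N-size ← βₛ-attained G (P ∖ Q) =
      ℕ.*-cancelʳ-≤ _ _ 2 (subst₂ _≤_
        (trans (∑-+ (ind ∘ moves (mate M)) _) (trans (cong₂ _+_ M-size N-size)
          (sym (ℕ.*-distribʳ-+ 2 (βₛ G Q) _))))
        refl
        (ℕ.≤-trans (∑-mono pointwise) (βₛ-maximal G P union)))
      where
      f : Fin n → Fin n
      f v = if Q v then mate M v else mate N v

      f-in : ∀ {v} → Q v ≡ true → f v ≡ mate M v
      f-in qv rewrite qv = refl

      f-out : ∀ {v} → ¬ Q v ≡ true → f v ≡ mate N v
      f-out ¬qv rewrite ≢true ¬qv = refl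

      Q-mate : ∀ {v} → Q v ≡ true → Q (mate M v) ≡ true
      Q-mate {v} qv with mate M v ≟ v
      ... | yes eq   = subst (λ w → Q w ≡ true) (sym eq) qv
      ... | no moved = inside M _ (mate-moved M moved)

      ¬Q-mate : ∀ {v} → ¬ Q v ≡ true → ¬ Q (mate N v) ≡ true
      ¬Q-mate {v} ¬qv with mate N v ≟ v
      ... | yes eq   = subst (λ w → ¬ Q w ≡ true) (sym eq) ¬qv
      ... | no moved = proj₂ (∖⁻ {P = P} {Q} _ (inside N _ (mate-moved N moved)))

      by-side : (R : Fin n → Fin n → Set) → (∀ v → Q v ≡ true → R v (mate M v)) →
                (∀ v → ¬ Q v ≡ true → R v (mate N v)) → ∀ v → R v (f v)
      by-side R r-in r-out v with Q v ≟ᵇ true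
      ... | yes qv = subst (R v) (sym (f-in qv)) (r-in v qv)
      ... | no ¬qv = subst (R v) (sym (f-out ¬qv)) (r-out v ¬qv)

      union : Mate G P
      union .mate = f
      union .involutive = by-side (λ v w → f w ≡ v)
        (λ v qv → trans (f-in (Q-mate qv)) (involutive M v))
        (λ v ¬qv → trans (f-out (¬Q-mate ¬qv)) (involutive N v))
      union .edge = by-side (λ v w → w ≢ v → v ~ w) (λ v _ → edge M v) (λ v _ → edge N v)
      union .inside = by-side (λ v w → w ≢ v → P v ≡ true)
        (λ v qv _ → Q⊆P v qv) (λ v _ moved → ∖-⊆ {P = P} {Q} v (inside N v moved))

      pointwise : ∀ v → ind (moves (mate M) v) + ind (moves (mate N) v) ≤ ind (moves f v)
      pointwise = by-side
        (λ v w → ind (moves (mate M) v) + ind (moves (mate N) v) ≤ ind (not (does (w ≟ v))))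
        (λ v qv → right-zero (cong ind (≢true λ moved →
          proj₂ (∖⁻ {P = P} {Q} v (inside N v (moves⁻ {f = mate N} moved))) qv)))
        (λ v ¬qv → left-zero (cong ind (≢true λ moved →
          ¬qv (inside M v (moves⁻ {f = mate M} moved)))))
        where
        right-zero : ∀ {x y} → y ≡ 0 → x + y ≤ x
        right-zero {x} refl = ℕ.≤-reflexive (ℕ.+-identityʳ x)
        left-zero : ∀ {x y} → x ≡ 0 → x + y ≤ y
        left-zero refl = ℕ.≤-refl

  module _ {P Q : Subsetᵇ n} (closed : Closed G P Q) (M : Mate G P) where
    private
      f : Fin n → Fin n
      f v = if Q v then mate M v else v

      f-in : ∀ {v} → Q v ≡ true → f v ≡ mate M v
      f-in qv rewrite qv = refl

      by-side : (R : Fin n → Fin n → Set) → (∀ v → Q v ≡ true → R v (mate M v)) →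
                (∀ v → ¬ Q v ≡ true → R v v) → ∀ v → R v (f v)
      by-side R r-in r-out v with Q v ≟ᵇ true
      ... | yes qv rewrite qv = r-in v qv
      ... | no ¬qv rewrite ≢true ¬qv = r-out v ¬qv

      Q-mate : ∀ {v} → Q v ≡ true → Q (mate M v) ≡ true
      Q-mate {v} qv with mate M v ≟ v
      ... | yes eq   = subst (λ w → Q w ≡ true) (sym eq) qv
      ... | no moved = closed qv (inside M _ (mate-moved M moved)) (edge M v moved)

    part : Mate G Q
    part .mate = f
    part .involutive = by-side (λ v w → f w ≡ v)
      (λ v qv → trans (f-in (Q-mate qv)) (involutive M v))
      (λ v ¬qv → cong (λ b → if b then mate M v else v) (≢true ¬qv))
    part .edge = by-side (λ v w → w ≢ v → v ~ w)
      (λ v _ → edge M v) (λ v _ v≢v → contradiction refl v≢v)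
    part .inside = by-side (λ v w → w ≢ v → Q v ≡ true)
      (λ v qv _ → qv) (λ v _ v≢v → contradiction refl v≢v)

    part-moves : ∀ {v} → Q v ≡ true → moves (mate M) v ≡ moves (mate part) v
    part-moves {v} qv = cong (λ w → not (does (w ≟ v))) (sym (f-in qv))

  -- A matching of `P` has no edge across the split, so it falls apart into a matching of each side.
  βₛ-subadditive : ∀ {P Q} → Q ⊆ P → Closed G P Q → βₛ G P ≤ βₛ G Q + βₛ G (P ∖ Q)
  βₛ-subadditive {P} {Q} Q⊆P closed with M , M-size ← βₛ-attained G P =
    ℕ.*-cancelʳ-≤ _ _ 2 (begin
      βₛ G P * 2                          ≡⟨ M-size ⟨
      size M                             ≤⟨ ∑-mono pointwise ⟩
      ∑ (λ v → ind (moves (mate M₁) v) + ind (moves (mate M₂) v))  ≡⟨ ∑-+ _ _ ⟩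
      size M₁ + size M₂
        ≤⟨ ℕ.+-mono-≤ (βₛ-maximal G Q M₁) (βₛ-maximal G (P ∖ Q) M₂) ⟩
      βₛ G Q * 2 + βₛ G (P ∖ Q) * 2        ≡⟨ ℕ.*-distribʳ-+ 2 (βₛ G Q) _ ⟨
      (βₛ G Q + βₛ G (P ∖ Q)) * 2          ∎)
    where
    open ℕ.≤-Reasoning
    closed′ : Closed G P (P ∖ Q)
    closed′ = Closed-∖ {P} {Q} closed Q⊆P

    M₁ : Mate G Q
    M₁ = part {Q = Q} closed M

    M₂ : Mate G (P ∖ Q)
    M₂ = part {Q = P ∖ Q} closed′ M

    pointwise : ∀ v → ind (moves (mate M) v) ≤ ind (moves (mate M₁) v) + ind (moves (mate M₂) v)
    pointwise v = cases (moves (mate M) v ≟ᵇ true) (Q v ≟ᵇ true)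
      where
      cases : Dec (moves (mate M) v ≡ true) → Dec (Q v ≡ true) →
              ind (moves (mate M) v) ≤ ind (moves (mate M₁) v) + ind (moves (mate M₂) v)
      cases (no fixed) _ = ℕ.≤-trans (ℕ.≤-reflexive (cong ind (≢true fixed))) z≤n
      cases (yes _) (yes qv) = ℕ.≤-trans
        (ℕ.≤-reflexive (cong ind (part-moves {Q = Q} closed M qv))) (ℕ.m≤m+n _ _)
      cases (yes moved) (no ¬qv) = ℕ.≤-trans
        (ℕ.≤-reflexive (cong ind (part-moves {Q = P ∖ Q} closed′ M
          (∖⁺ {P = P} {Q} (inside M v (moves⁻ {f = mate M} moved)) ¬qv))))
        (ℕ.m≤n+m _ (ind (moves (mate M₁) v)))

-- Graphs in which every vertex is missed by some maximum matching.

module _ {G : Graph n} {P : Subsetᵇ n} where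
  open Graph G

  -- No vertex of P is covered by every maximum matching.
  Inessential : Set
  Inessential = ∀ t → P t ≡ true → βₛ G P ≤ βₛ G (P ∖ ⁅ t ⁆)

  -- A maximum matching of `Q` is already large enough for `P`, and it fixes everything outside `Q`.
  maximum-avoiding : ∀ Q → (∀ v → Q v ≡ true → P v ≡ true) → βₛ G P ≤ βₛ G Q →
    Σ[ M ∈ Mate G P ] (Maximum G M × (∀ v → ¬ Q v ≡ true → mate M v ≡ v))
  maximum-avoiding Q Q⊆P le with M , M-size ← βₛ-attained G Q =
    M′ , ℕ.≤-antisym (size≤ G M′) (ℕ.≤-trans (ℕ.*-monoˡ-≤ 2 le) (ℕ.≤-reflexive (sym M-size))) ,
    λ v ¬q → case mate M v ≟ v of λ
      { (yes free) → free ; (no moved) → contradiction (inside M v moved) ¬q }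
    where
    M′ : Mate G P
    M′ = restrict M λ v moved → Q⊆P v (inside M v moved)

  -- `⋈` quantifies over all matchings; this numerical form is decidable, so that a class can be a
  -- Boolean subset.
  ⋈⇔ : ∀ {u v} → (βₛ G (P ∖ ⁅ u ⁆ ∖ ⁅ v ⁆) < βₛ G P → _⋈_ G {P} u v)
                 × (_⋈_ G {P} u v → βₛ G (P ∖ ⁅ u ⁆ ∖ ⁅ v ⁆) < βₛ G P)
  ⋈⇔ {u} {v} = to , from
    where
    P′ = P ∖ ⁅ u ⁆ ∖ ⁅ v ⁆

    P′⁻ : ∀ w → P′ w ≡ true → P w ≡ true × ¬ ⁅ u ⁆ w ≡ true × ¬ ⁅ v ⁆ w ≡ true
    P′⁻ w w∈ =
      let w∈′ , w∉v = ∖⁻ {P = P ∖ ⁅ u ⁆} {⁅ v ⁆} w w∈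
          pw , w∉u  = ∖⁻ {P = P} {⁅ u ⁆} w w∈′
      in pw , w∉u , w∉v

    to : βₛ G P′ < βₛ G P → _⋈_ G {P} u v
    to b< M M-max u-free v-free = ℕ.<⇒≱ b< (ℕ.*-cancelʳ-≤ _ _ 2 (subst (_≤ βₛ G P′ * 2) M-max
      (βₛ-maximal G P′ (restrict M λ w moved →
        ∖⁺ {P = P ∖ ⁅ u ⁆} {⁅ v ⁆} (∖⁺ {P = P} {⁅ u ⁆} (inside M w moved)
          (λ w∈ → moved (subst (λ z → mate M z ≡ z) (sym (⁅⁆⁻ w∈)) u-free)))
          (λ w∈ → moved (subst (λ z → mate M z ≡ z) (sym (⁅⁆⁻ w∈)) v-free))))))

    from : _⋈_ G {P} u v → βₛ G P′ < βₛ G P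
    from u⋈v = ℕ.≰⇒> λ le →
      let M , M-max , free = maximum-avoiding P′ (λ w → proj₁ ∘ P′⁻ w) le
      in u⋈v M M-max (free u λ u∈ → proj₁ (proj₂ (P′⁻ u u∈)) (⁅⁆⁺ u))
                     (free v λ v∈ → proj₂ (proj₂ (P′⁻ v v∈)) (⁅⁆⁺ v))

  module _ (inessential : Inessential) where

    maximum-missing : ∀ {t} → P t ≡ true → Σ[ M ∈ Mate G P ] (Maximum G M × mate M t ≡ t)
    maximum-missing {t} pt
      with M , M-max , free ← maximum-avoiding (P ∖ ⁅ t ⁆) (∖-⊆ {P = P} {⁅ t ⁆}) (inessential t pt) =
      M , M-max , free t λ t∈ → proj₂ (∖⁻ {P = P} {⁅ t ⁆} t t∈) (⁅⁆⁺ t)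

    ⋈-sym : ∀ {u v} → _⋈_ G {P} u v → _⋈_ G {P} v u
    ⋈-sym u⋈v M M-max v-free u-free = u⋈v M M-max u-free v-free

    -- If a maximum matching missed both `u` and `v`, Gallai's lemma would force every maximum
    -- matching to cover `t`; but some maximum matching misses `t`.
    ⋈-trans : ∀ {u t v} → P t ≡ true → u ≢ v → _⋈_ G {P} u t → _⋈_ G {P} t v → _⋈_ G {P} u v
    ⋈-trans {u} {t} {v} pt u≢v u⋈t t⋈v M M-max u-free v-free
      with N , N-max , t-free ← maximum-missing pt =
      no-maximum-missing G u≢v (⋈-sym u⋈t) t⋈v M M-max u-free v-free N N-max t-free

    -- A maximum matching that misses `t` must cover all other vertices of `P`.
    factor-critical : ∀ {t} → P t ≡ true → (∀ w → P w ≡ true → w ≢ t → _⋈_ G {P} t w) →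
                      count P ≡ suc (βₛ G P * 2)
    factor-critical {t} pt all with N , N-max , t-free ← maximum-missing pt =
      trans (count-remove {P = P} pt) (cong suc (trans
        (ℕ.≤-antisym
          (count-mono {P = P ∖ ⁅ t ⁆} {moves (mate N)} λ w w∈ →
            let pw , w≢t = ∖⁻ {P = P} {⁅ t ⁆} w w∈
            in moves⁺ {f = mate N} (all w pw (λ { refl → w≢t (⁅⁆⁺ w) }) N N-max t-free))
          (count-mono {P = moves (mate N)} {P ∖ ⁅ t ⁆} λ w w∈ →
            let moved = moves⁻ {f = mate N} {w} w∈
            in ∖⁺ {P = P} {⁅ t ⁆} (inside N w moved) λ w≡t →
              moved (subst (λ z → mate N z ≡ z) (sym (⁅⁆⁻ w≡t)) t-free)))
        N-max))

    ⋈-class-closed : ∀ {t u w} → P t ≡ true → P u ≡ true → P w ≡ true →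
      u ≡ t ⊎ _⋈_ G {P} t u → u ~ w → w ≡ t ⊎ _⋈_ G {P} t w
    ⋈-class-closed {t} {u} {w} pt pu pw t-u u~w with w ≟ t
    ... | yes w≡t = inj₁ w≡t
    ... | no w≢t with t-u
    ...   | inj₁ refl = inj₂ (adjacent⇒⋈ G pu pw u~w)
    ...   | inj₂ t⋈u  = inj₂ (⋈-trans pu (≢-sym w≢t) t⋈u (adjacent⇒⋈ G pu pw u~w))

-- Arithmetic of a single class of odd order.

Exceptional : ℕ → ℕ → Set
Exceptional N A = (N ≡ 1 × A ≡ 1) ⊎ (N ≡ 5 × A ≡ 2) ⊎ (N ≡ 13 × A ≡ 4)

weight-antitone : ∀ {d d′} → d ≤ d′ → weight d′ ≤ weight d
weight-antitone {d} {d′} d≤d′ = ℕ.≤-trans (ℕ.m≤m+n _ _)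
  (weight-convex d′ 0 d (subst (_≤ d′) (sym (ℕ.+-identityʳ d)) d≤d′))

private
  from-product : ∀ {N w c} k → c < suc k * w → N * w ≤ c → N ≤ k
  from-product {N} {w} k c< Nw≤c = s≤s⁻¹ (ℕ.≰⇒> λ k<N →
    ℕ.<⇒≱ c< (ℕ.≤-trans (ℕ.*-monoˡ-≤ w k<N) Nw≤c))

  half : ∀ {B} k → suc (B * 2) ≤ suc (k * 2) → B ≤ k
  half {B} k le = ℕ.*-cancelʳ-≤ B k 2 (s≤s⁻¹ le)

  -- If the claim failed, 4A would be at most N + 3 for N = 2B + 1. Multiplying by 254 and using 254
  -- N ≤ 850 A leaves 166 A ≤ 762, where 166 = 4 · 254 - 850 and 762 = 3 · 254; but 5 · 166 = 830.
  large : ∀ A B → 5 ≤ A → suc (B * 2) * 254 ≤ A * 850 → B + 2 < A * 2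
  large A B 5≤A le = ℕ.≰⇒> λ 2A≤ → ℕ.<⇒≱ 762<A*166 (ℕ.+-cancelˡ-≤ (A * 850) _ _ (begin
    A * 850 + A * 166              ≡⟨ ℕ.*-distribˡ-+ A 850 166 ⟨
    A * (4 * 254)                  ≡⟨ ℕ.*-assoc A 4 254 ⟨
    A * 4 * 254                    ≤⟨ ℕ.*-monoˡ-≤ 254 (quadruple 2A≤) ⟩
    (suc (B * 2) + 3) * 254        ≡⟨ ℕ.*-distribʳ-+ 254 (suc (B * 2)) 3 ⟩
    suc (B * 2) * 254 + 3 * 254    ≤⟨ ℕ.+-monoˡ-≤ 762 le ⟩
    A * 850 + 762                  ∎))
    where
    open ℕ.≤-Reasoning
    762<A*166 : 762 < A * 166
    762<A*166 = ℕ.<-≤-trans (from-yes (762 ℕ.<? 830)) (ℕ.*-monoˡ-≤ 166 5≤A)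

    quadruple : A * 2 ≤ B + 2 → A * 4 ≤ suc (B * 2) + 3
    quadruple 2A≤ = begin
      A * 4              ≡⟨ ℕ.*-assoc A 2 2 ⟨
      A * 2 * 2          ≤⟨ ℕ.*-monoˡ-≤ 2 2A≤ ⟩
      (B + 2) * 2        ≡⟨ ℕ.*-distribʳ-+ 2 B 2 ⟩
      B * 2 + 4          ≡⟨ ℕ.+-suc (B * 2) 3 ⟩
      suc (B * 2) + 3    ∎

-- For N = 2B + 1 the bound 2N ≤ 2A + 3B reads B + 2 ≤ 2A. In the cases A = 1, ..., 4 the limit
-- passed to `from-product` is 850 A divided by the weight and rounded down.
odd-order-bound : ∀ A B → suc (B * 2) * weight (A ⊓ 4) ≤ A * 850 →
  B + 2 < A * 2 ⊎ (B + 2 ≡ A * 2 × Exceptional (suc (B * 2)) A)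
odd-order-bound 0 B ()
odd-order-bound 1 B le with B
... | zero  = inj₂ (refl , inj₁ (refl , refl))
... | suc B = contradiction
  (from-product {suc (suc B * 2)} {425} 2 (from-yes (850 ℕ.<? 1275)) le)
  λ { (s≤s (s≤s ())) }
odd-order-bound 2 B le
  with ℕ.m≤n⇒m<n∨m≡n (half {B} 2 (from-product {suc (B * 2)} {340} 5 (from-yes (1700 ℕ.<? 2040)) le))
... | inj₁ B<2  = inj₁ (ℕ.+-monoˡ-< 2 B<2)
... | inj₂ refl = inj₂ (refl , inj₂ (inj₁ (refl , refl)))
-- Equality would need B = 4, so N = 9, but the weight allows only N ≤ 8.
odd-order-bound 3 B le = inj₁ (ℕ.+-monoˡ-< 2 (ℕ.*-cancelʳ-< 2 B 4
  (from-product {suc (B * 2)} {289} 8 (from-yes (2550 ℕ.<? 2601)) le)))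
odd-order-bound 4 B le
  with ℕ.m≤n⇒m<n∨m≡n (half {B} 6 (from-product {suc (B * 2)} {254} 13 (from-yes (3400 ℕ.<? 3556)) le))
... | inj₁ B<6  = inj₁ (ℕ.+-monoˡ-< 2 B<6)
... | inj₂ refl = inj₂ (refl , inj₂ (inj₂ (refl , refl)))
odd-order-bound A@(suc (suc (suc (suc (suc _))))) B le =
  inj₁ (large A B (s≤s (s≤s (s≤s (s≤s (s≤s z≤n))))) le)

-- The bound for all vertex subsets, by induction on their size.

module _ {G : Graph n} (triangle-free : TriangleFree G) where
  open Graph G

  deg≤αₛ : ∀ P u → deg G P u ≤ αₛ G P
  deg≤αₛ P u = αₛ-maximal G P
    ( adj G P u
    , (λ v uv → proj₁ (proj₂ (adj⁻ G P uv)))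
    , (λ v w uv uw v~w → triangle-free
        (proj₂ (proj₂ (adj⁻ G P uv))) v~w (~-sym (proj₂ (proj₂ (adj⁻ G P uw)))))
    , refl )

module _ (G : Graph n) where

  value : Subsetᵇ n → ℕ
  value P = αₛ G P * 2 + βₛ G P * 3

  value-+ : ∀ a₁ b₁ a₂ b₂ → a₁ * 2 + b₁ * 3 + (a₂ * 2 + b₂ * 3) ≡ (a₁ + a₂) * 2 + (b₁ + b₂) * 3
  value-+ = solve-∀

  value-superadditive : ∀ {P Q} → Q ⊆ P → Closed G P Q → value Q + value (P ∖ Q) ≤ value P
  value-superadditive {P} {Q} Q⊆P closed = subst (_≤ value P)
    (sym (value-+ (αₛ G Q) (βₛ G Q) (αₛ G (P ∖ Q)) (βₛ G (P ∖ Q))))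
    (ℕ.+-mono-≤ (ℕ.*-monoˡ-≤ 2 (αₛ-superadditive {Q = Q} Q⊆P closed))
      (ℕ.*-monoˡ-≤ 3 (βₛ-superadditive Q⊆P)))

  value-subadditive : ∀ {P Q} → Q ⊆ P → Closed G P Q → value P ≤ value Q + value (P ∖ Q)
  value-subadditive {P} {Q} Q⊆P closed = subst (value P ≤_)
    (sym (value-+ (αₛ G Q) (βₛ G Q) (αₛ G (P ∖ Q)) (βₛ G (P ∖ Q))))
    (ℕ.+-mono-≤ (ℕ.*-monoˡ-≤ 2 (αₛ-subadditive Q⊆P))
      (ℕ.*-monoˡ-≤ 3 (βₛ-subadditive {Q = Q} Q⊆P closed)))

module _ {G : Graph n} (triangle-free : TriangleFree G) (deg≤4 : ∀ P u → deg G P u ≤ 4) where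
  open Graph G

  order-weight : ∀ P → count P * weight (αₛ G P ⊓ 4) ≤ αₛ G P * 850
  order-weight P
    with T , T⊆P , T-indep , le ← weighted-independent G triangle-free (count P) P ℕ.≤-refl =
    begin
      count P * weight (αₛ G P ⊓ 4)                ≡⟨ ∑-* (ind ∘ P) _ ⟩
      ∑ (λ u → ind (P u) * weight (αₛ G P ⊓ 4))
        ≤⟨ ∑-mono (λ u → ℕ.*-monoʳ-≤ (ind (P u))
             (weight-antitone (ℕ.⊓-glb (deg≤αₛ triangle-free P u) (deg≤4 P u)))) ⟩
      totalWeight G P                             ≤⟨ le ⟩
      count T * 850
        ≤⟨ ℕ.*-monoˡ-≤ 850 (αₛ-maximal G P (T , T⊆P , T-indep , refl)) ⟩
      αₛ G P * 850                                 ∎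
    where open ℕ.≤-Reasoning

  critical-bound : ∀ P → count P ≡ suc (βₛ G P * 2) →
    count P * 2 < value G P ⊎ (count P * 2 ≡ value G P × Exceptional (count P) (αₛ G P))
  critical-bound P order≡ with odd-order-bound (αₛ G P) (βₛ G P)
    (subst (λ N → N * weight (αₛ G P ⊓ 4) ≤ αₛ G P * 850) order≡ (order-weight P))
  ... | inj₁ <2a = inj₁ (begin-strict
    count P * 2                  ≡⟨ cong (_* 2) order≡ ⟩
    suc (βₛ G P * 2) * 2          ≡⟨ regroup (βₛ G P) ⟩
    βₛ G P + 2 + βₛ G P * 3        <⟨ ℕ.+-monoˡ-< (βₛ G P * 3) <2a ⟩
    value G P                      ∎)
    where
    open ℕ.≤-Reasoning
    regroup : ∀ b → suc (b * 2) * 2 ≡ b + 2 + b * 3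
    regroup = solve-∀
  ... | inj₂ (≡2a , exceptional) = inj₂
    (equal , subst (λ N → Exceptional N (αₛ G P)) (sym order≡) exceptional)
    where
    regroup : ∀ b → suc (b * 2) * 2 ≡ b + 2 + b * 3
    regroup = solve-∀
    equal : count P * 2 ≡ value G P
    equal = trans (cong (_* 2) order≡) (trans (regroup (βₛ G P)) (cong (_+ βₛ G P * 3) ≡2a))

  -- Restoring `t` adds 2 to the left side and at least 3 to the right, which is where strictness
  -- comes from.
  essential-bound : ∀ {P t} → P t ≡ true → βₛ G (P ∖ ⁅ t ⁆) < βₛ G P →
    count (P ∖ ⁅ t ⁆) * 2 ≤ value G (P ∖ ⁅ t ⁆) → count P * 2 < value G P
  essential-bound {P} {t} pt b< le = begin-strict
    count P * 2                                        ≡⟨ cong (_* 2) (count-remove {P = P} pt) ⟩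
    2 + count (P ∖ ⁅ t ⁆) * 2                          ≤⟨ ℕ.+-monoʳ-≤ 2 le ⟩
    2 + value G (P ∖ ⁅ t ⁆)                              <⟨ ℕ.n<1+n _ ⟩
    3 + (αₛ G (P ∖ ⁅ t ⁆) * 2 + βₛ G (P ∖ ⁅ t ⁆) * 3)
      ≡⟨ regroup (αₛ G (P ∖ ⁅ t ⁆) * 2) (βₛ G (P ∖ ⁅ t ⁆)) ⟩
    αₛ G (P ∖ ⁅ t ⁆) * 2 + suc (βₛ G (P ∖ ⁅ t ⁆)) * 3
      ≤⟨ ℕ.+-mono-≤ (ℕ.*-monoˡ-≤ 2 (αₛ-mono (∖-⊆ {P = P} {⁅ t ⁆}))) (ℕ.*-monoˡ-≤ 3 b<) ⟩
    value G P                                            ∎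
    where
    open ℕ.≤-Reasoning
    regroup : ∀ x y → 3 + (x + y * 3) ≡ x + suc y * 3
    regroup = solve-∀

  inessential⊎essential : ∀ P → Inessential {G = G} {P} ⊎
    ∃[ t ] (P t ≡ true × βₛ G (P ∖ ⁅ t ⁆) < βₛ G P)
  inessential⊎essential P with any? (λ t → (P t ≟ᵇ true) ×-dec (βₛ G (P ∖ ⁅ t ⁆) ℕ.<? βₛ G P))
  ... | yes found = inj₂ found
  ... | no ∄ = inj₁ λ t pt → ℕ.≮⇒≥ λ b< → ∄ (t , pt , b<)

  -- The bound `k` makes strong induction structural: the parts of a split may have any smaller
  -- size.
  order≤value-upTo : ∀ k P → count P ≤ k → count P * 2 ≤ value G P
  order≤value-upTo k P size≤k with empty⊎member P
  ... | inj₁ size≡0 = subst (λ N → N * 2 ≤ value G P) (sym size≡0) z≤n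
  order≤value-upTo zero P size≤k | inj₂ (v , pv) = contradiction (ℕ.≤-trans (count-pos pv) size≤k) λ ()
  order≤value-upTo (suc k) P size≤k | inj₂ (v , pv) with inessential⊎essential P
  ... | inj₂ (t , pt , b<) = ℕ.<⇒≤ (essential-bound pt b< (order≤value-upTo k (P ∖ ⁅ t ⁆)
    (s≤s⁻¹ (subst (_≤ suc k) (count-remove {P = P} pt) size≤k))))
  ... | inj₁ inessential = cases (any? λ w → (P ∖ K) w ≟ᵇ true)
    where
    -- The class of `v`, with `v` put in explicitly and `⋈` replaced by its decidable form.
    K : Subsetᵇ n
    K w = P w ∧ (⁅ v ⁆ w ∨ does (βₛ G (P ∖ ⁅ v ⁆ ∖ ⁅ w ⁆) ℕ.<? βₛ G P))

    K⊆P : K ⊆ P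
    K⊆P w = proj₁ ∘ ∧⁻

    K⁻ : ∀ {w} → K w ≡ true → w ≡ v ⊎ _⋈_ G {P} v w
    K⁻ {w} kw with ⁅ v ⁆ w ≟ᵇ true
    ... | yes w∈ = inj₁ (⁅⁆⁻ w∈)
    ... | no w∉ = inj₂ (proj₁ ⋈⇔ (does⁻ (_ ℕ.<? _)
      (subst (λ x → x ∨ does (βₛ G (P ∖ ⁅ v ⁆ ∖ ⁅ w ⁆) ℕ.<? βₛ G P) ≡ true)
        (≢true w∉) (proj₂ (∧⁻ {P w} kw)))))

    K⁺ : ∀ {w} → P w ≡ true → w ≡ v ⊎ _⋈_ G {P} v w → K w ≡ true
    K⁺ {w} pw (inj₁ refl) = ∧⁺ pw (cong (_∨ does (βₛ G (P ∖ ⁅ v ⁆ ∖ ⁅ w ⁆) ℕ.<? βₛ G P)) (⁅⁆⁺ w))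
    K⁺ {w} pw (inj₂ v⋈w) = ∧⁺ pw (trans
      (cong (⁅ v ⁆ w ∨_) (dec-true (_ ℕ.<? _) (proj₂ (⋈⇔ {G = G} {P}) v⋈w))) (∨-zeroʳ _))

    K-closed : Closed G P K
    K-closed {u} ku pw u~w =
      K⁺ pw (⋈-class-closed inessential pv (K⊆P u ku) pw (K⁻ ku) u~w)

    cases : Dec (∃[ w ] (P ∖ K) w ≡ true) → count P * 2 ≤ value G P
    cases (no ∄) with critical-bound P (factor-critical inessential pv λ w pw w≢v →
        case K⁻ (case K w ≟ᵇ true of λ
          { (yes kw) → kw ; (no ¬kw) → contradiction (w , ∖⁺ {P = P} {K} pw ¬kw) ∄ })
        of λ { (inj₁ w≡v) → contradiction w≡v w≢v ; (inj₂ v⋈w) → v⋈w })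
    ... | inj₁ lt       = ℕ.<⇒≤ lt
    ... | inj₂ (eq , _) = ℕ.≤-reflexive eq
    -- Both parts are smaller than `P`, since `v` lies in `K` and `w` does not.
    cases (yes (w , w∈)) = begin
      count P * 2                           ≡⟨ cong (_* 2) split ⟩
      (count K + count (P ∖ K)) * 2         ≡⟨ ℕ.*-distribʳ-+ 2 (count K) _ ⟩
      count K * 2 + count (P ∖ K) * 2
        ≤⟨ ℕ.+-mono-≤
             (order≤value-upTo k K (s≤s⁻¹ (ℕ.≤-trans (ℕ.≤-trans
               (ℕ.≤-reflexive (ℕ.+-comm 1 _)) (ℕ.+-monoʳ-≤ (count K) (count-pos w∈))) total≤)))
             (order≤value-upTo k (P ∖ K) (s≤s⁻¹ (ℕ.≤-trans
               (ℕ.+-monoˡ-≤ (count (P ∖ K)) (count-pos {P = K} (K⁺ pv (inj₁ refl)))) total≤))) ⟩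
      value G K + value G (P ∖ K)               ≤⟨ value-superadditive G {Q = K} K⊆P K-closed ⟩
      value G P                               ∎
      where
      open ℕ.≤-Reasoning
      split : count P ≡ count K + count (P ∖ K)
      split = count-∖ {P = P} {K} K⊆P

      total≤ : count K + count (P ∖ K) ≤ suc k
      total≤ = subst (_≤ suc k) split size≤k

  order≤value : ∀ P → count P * 2 ≤ value G P
  order≤value P = order≤value-upTo (count P) P ℕ.≤-refl

-- Elementary estimates, and comparison with `α`, `β` and `Δ`.

module _ (G : Graph n) (P : Subsetᵇ n) where

  αₛ≤order : αₛ G P ≤ count P
  αₛ≤order with T , T⊆P , _ , T-size ← αₛ-attained G P = subst (_≤ count P) T-size (count-mono T⊆P)

  2βₛ≤order : βₛ G P * 2 ≤ count P
  2βₛ≤order with M , M-size ← βₛ-attained G P = subst (_≤ count P) M-size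
    (count-mono {P = moves (mate M)} λ w w∈ → inside M w (moves⁻ {f = mate M} w∈))

module _ {H : Graph m} {G : Graph n} {P : Subsetᵇ n} (H≼G : Presents H G P) where

  α-presented : α H ≡ αₛ G P
  α-presented = ℕ.≤-antisym
    (αₛ-maximal G P (α-attained H≼G)) (α-maximal H≼G (αₛ-attained G P))

  β-presented : β H ≡ βₛ G P
  β-presented
    with M , M-size ← β-attained H≼G
    with N , N-size ← βₛ-attained G P = ℕ.≤-antisym
    (ℕ.*-cancelʳ-≤ _ _ 2 (subst (_≤ βₛ G P * 2) M-size (βₛ-maximal G P M)))
    (ℕ.*-cancelʳ-≤ _ _ 2 (subst (_≤ β H * 2) N-size (β-maximal H≼G N)))

deg≤Δ : ∀ (G : Graph n) P u → deg G P u ≤ Δ G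
deg≤Δ {n} G P u = begin
  deg G P u                          ≤⟨ count-mono {P = adj G P u} {λ w → does (u ~? w)}
                                          (λ w uw → dec-true (u ~? w) (proj₂ (proj₂ (adj⁻ G P uw)))) ⟩
  count (λ w → does (u ~? w))        ≡⟨ ∣tabulate∣ _ ⟨
  degree G u                         ≤⟨ ListAll.lookup (xs≤max 0 _) (∈-map⁺ (degree G) (∈-allFin u)) ⟩
  Δ G                                ∎
  where
  open Graph G
  open ℕ.≤-Reasoning

-- Connected components and the case of equality.

module _ (G : Graph n) where
  open Graph G

  Component : Fin n → Subsetᵇ n → Set
  Component v Q = ∀ w → Q w ≡ true ⇔ Star _~_ v w

  private
    -- Builds the reachable set by repeatedly adding the far end of an edge that leaves `Q`. Each
    -- addition trades one unit of `k` for one of `count Q`, and `count Q ≤ n` keeps `k` from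
    -- running out.
    saturate : ∀ v k Q → Q v ≡ true → (∀ w → Q w ≡ true → Star _~_ v w) → n < count Q + k →
               ∃ (Component v)
    saturate v zero Q _ _ n< =
      contradiction (subst (n <_) (ℕ.+-identityʳ _) n<) (ℕ.≤⇒≯ (count≤n Q))
    saturate v (suc k) Q qv reach n<
      with any? (λ u → any? λ w → (Q u ≟ᵇ true) ×-dec (Q w ≟ᵇ false) ×-dec (u ~? w))
    ... | no ∄ = Q , λ w → mk⇔ (reach w) (along qv)
      where
      along : ∀ {u w} → Q u ≡ true → Star _~_ u w → Q w ≡ true
      along qu ε = qu
      along {u} qu (_◅_ {j = w} u~w rest) with Q w ≟ᵇ true
      ... | yes qw = along qw rest
      ... | no ¬qw = contradiction (u , w , qu , ≢true ¬qw , u~w) ∄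
    ... | yes (u , w , qu , ¬qw , u~w) =
      saturate v k (insert w Q) (insert-⊆ {v = w} {Q} v qv) reach′
        (subst (n <_) (trans (ℕ.+-suc (count Q) k)
          (cong (_+ k) (sym (count-insert {v = w} {Q} (false≢true ¬qw))))) n<)
      where
      reach′ : ∀ z → insert w Q z ≡ true → Star _~_ v z
      reach′ z z∈ with insert⁻ {v = w} {Q} z∈
      ... | inj₁ refl = reach u qu ◅◅ (u~w ◅ ε)
      ... | inj₂ qz   = reach z qz

  component : ∀ v → ∃ (Component v)
  component v = saturate v (suc n) ⁅ v ⁆ (⁅⁆⁺ v)
    (λ w w∈ → subst (Star _~_ v) (sym (⁅⁆⁻ w∈)) ε) (ℕ.m≤n+m (suc n) _)

  component-closed : ∀ {v Q} → Component v Q → ∀ {u w} → Q u ≡ true → u ~ w → Q w ≡ true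
  component-closed comp {u} {w} qu u~w =
    Equivalence.from (comp w) (Equivalence.to (comp u) qu ◅◅ (u~w ◅ ε))

module _ {G : Graph n} (triangle-free : TriangleFree G) (deg≤4 : ∀ P u → deg G P u ≤ 4) where
  open Graph G

  module _ {v : Fin n} {Q : Subsetᵇ n} (comp : Component G v Q) where
    private
      qv : Q v ≡ true
      qv = Equivalence.from (comp v) ε

      closed : ∀ {P} → Closed G P Q
      closed qu _ = component-closed G comp qu

    -- The complement obeys the bound as well, so slack on `Q` could not be made up elsewhere and
    -- would survive in the total.
    component-tight : value G full ≤ count {n} full * 2 → count Q * 2 ≡ value G Q
    component-tight tight = ℕ.≤-antisym (order≤value triangle-free deg≤4 Q)
      (ℕ.+-cancelʳ-≤ (value G (full ∖ Q)) _ _ (begin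
      value G Q + value G (full ∖ Q)
        ≤⟨ value-superadditive G {P = full} {Q} (λ _ _ → refl) closed ⟩
      value G full                                ≤⟨ tight ⟩
      count {n} full * 2                      ≡⟨ cong (_* 2) (count-∖ {P = full} {Q} λ _ _ → refl) ⟩
      (count Q + count (full ∖ Q)) * 2        ≡⟨ ℕ.*-distribʳ-+ 2 (count Q) _ ⟩
      count Q * 2 + count (full ∖ Q) * 2
        ≤⟨ ℕ.+-monoʳ-≤ (count Q * 2) (order≤value triangle-free deg≤4 (full ∖ Q)) ⟩
      count Q * 2 + value G (full ∖ Q)            ∎))
      where open ℕ.≤-Reasoning

    module _ (tight : count Q * 2 ≡ value G Q) where

      component-inessential : Inessential {G = G} {Q}
      component-inessential t qt = ℕ.≮⇒≥ λ b< → ℕ.<-irrefl tight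
        (essential-bound triangle-free deg≤4 qt b< (order≤value triangle-free deg≤4 (Q ∖ ⁅ t ⁆)))

      -- Following a path from `v` never leaves the class of `v`, so a connected `Q` without
      -- essential vertices is one class.
      component-order : count Q ≡ suc (βₛ G Q * 2)
      component-order = factor-critical component-inessential qv λ w qw w≢v →
        case reach qv (inj₁ refl) (Equivalence.to (comp w) qw) of λ
          { (inj₁ w≡v) → contradiction w≡v w≢v ; (inj₂ v⋈w) → v⋈w }
        where
        reach : ∀ {u w} → Q u ≡ true → u ≡ v ⊎ _⋈_ G {Q} v u → Star _~_ u w →
                w ≡ v ⊎ _⋈_ G {Q} v w
        reach qu v-u ε = v-u
        reach qu v-u (u~w ◅ rest) =
          let qw = component-closed G comp qu u~w
          in reach qw (⋈-class-closed component-inessential qv qu qw v-u u~w) rest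

      component-exceptional : Exceptional (count Q) (αₛ G Q)
      component-exceptional = [ (λ lt → contradiction lt (ℕ.<-irrefl tight)) , proj₂ ]′
        (critical-bound triangle-free deg≤4 Q component-order)

  -- Peels off the component of some vertex of `P`. As no edge leaves `P`, this component lies
  -- inside `P`, and what remains is closed again.
  good-components : (∀ {v Q} → Component G v Q → value G Q ≤ count Q * 2) →
    ∀ k P → Closed G full P → count P ≤ k → value G P ≤ count P * 2
  good-components good k P closed size≤k with empty⊎member P
  ... | inj₁ size≡0 = ℕ.≤-trans (ℕ.+-mono-≤ (ℕ.*-monoˡ-≤ 2 a≤0) (ℕ.*-monoˡ-≤ 3 b≤0)) z≤n
    where
    a≤0 : αₛ G P ≤ 0
    a≤0 = subst (αₛ G P ≤_) size≡0 (αₛ≤order G P)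

    b≤0 : βₛ G P ≤ 0
    b≤0 = ℕ.*-cancelʳ-≤ _ 0 2 (subst (βₛ G P * 2 ≤_) size≡0 (2βₛ≤order G P))
  good-components good zero P closed size≤k | inj₂ (v , pv) =
    contradiction (ℕ.≤-trans (count-pos pv) size≤k) λ ()
  good-components good (suc k) P closed size≤k | inj₂ (v , pv) with Q , comp ← component G v =
    begin
      value G P                                ≤⟨ value-subadditive G Q⊆P
                                                (λ qu _ → component-closed G comp qu) ⟩
      value G Q + value G (P ∖ Q)                  ≤⟨ ℕ.+-mono-≤ (good comp)
                                                (good-components good k (P ∖ Q) rest-closed rest≤k) ⟩
      count Q * 2 + count (P ∖ Q) * 2      ≡⟨ ℕ.*-distribʳ-+ 2 (count Q) _ ⟨
      (count Q + count (P ∖ Q)) * 2        ≡⟨ cong (_* 2) (count-∖ {P = P} {Q} Q⊆P) ⟨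
      count P * 2                          ∎
    where
    open ℕ.≤-Reasoning
    along : ∀ {u w} → P u ≡ true → Star _~_ u w → P w ≡ true
    along pu ε            = pu
    along pu (u~w ◅ rest) = along (closed pu refl u~w) rest

    Q⊆P : Q ⊆ P
    Q⊆P w qw = along pv (Equivalence.to (comp w) qw)

    rest-closed : Closed G full (P ∖ Q)
    rest-closed {u} {w} u∈ _ u~w =
      let pu , ¬qu = ∖⁻ {P = P} {Q} u u∈
      in ∖⁺ {P = P} {Q} (closed pu refl u~w)
           λ qw → ¬qu (component-closed G comp qw (~-sym u~w))

    rest≤k : count (P ∖ Q) ≤ k
    rest≤k = s≤s⁻¹ (begin
      1 + count (P ∖ Q)          ≤⟨ ℕ.+-monoˡ-≤ _ (count-pos {P = Q} (Equivalence.from (comp v) ε)) ⟩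
      count Q + count (P ∖ Q)    ≡⟨ count-∖ {P = P} {Q} Q⊆P ⟨
      count P                    ≤⟨ size≤k ⟩
      suc k                      ∎)

-- Recognising the 5-cycle from its order and independence number.

two-members : ∀ {P : Subsetᵇ n} → count P ≡ 2 →
  ∃[ x ] ∃[ y ] (P x ≡ true × P y ≡ true × x ≢ y × (∀ w → P w ≡ true → w ≡ x ⊎ w ≡ y))
two-members {P = P} size with empty⊎member P
... | inj₁ size≡0 with () ← trans (sym size) size≡0
... | inj₂ (x , px) with empty⊎member (P ∖ ⁅ x ⁆)
...   | inj₁ none = contradiction
  (trans (sym size) (trans (count-remove {P = P} px) (cong suc none))) λ ()
...   | inj₂ (y , y∈) with empty⊎member (P ∖ ⁅ x ⁆ ∖ ⁅ y ⁆)
...     | inj₁ none = x , y , px , py , (λ { refl → y≢x (⁅⁆⁺ x) }) , cover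
  where
  py  = proj₁ (∖⁻ {P = P} {⁅ x ⁆} y y∈)
  y≢x = proj₂ (∖⁻ {P = P} {⁅ x ⁆} y y∈)

  cover : ∀ w → P w ≡ true → w ≡ x ⊎ w ≡ y
  cover w pw with w ≟ x | w ≟ y
  ... | yes w≡x | _       = inj₁ w≡x
  ... | no _    | yes w≡y = inj₂ w≡y
  ... | no w≢x  | no w≢y  = contradiction
    (subst (1 ≤_) none (count-pos {P = P ∖ ⁅ x ⁆ ∖ ⁅ y ⁆}
      (∖⁺ {P = P ∖ ⁅ x ⁆} {⁅ y ⁆} (∖⁺ {P = P} {⁅ x ⁆} pw (w≢x ∘ ⁅⁆⁻)) (w≢y ∘ ⁅⁆⁻))))
    λ ()
...     | inj₂ (z , z∈) = contradiction
  (subst (1 ≤_) (ℕ.suc-injective (ℕ.suc-injective (trans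
      (sym (trans (count-remove {P = P} px) (cong suc (count-remove {P = P ∖ ⁅ x ⁆} y∈)))) size)))
    (count-pos {P = P ∖ ⁅ x ⁆ ∖ ⁅ y ⁆} z∈))
  λ ()

injective⇒surjective : m ≡ n → (f : Fin m → Fin n) → (∀ {i j} → f i ≡ f j → i ≡ j) →
                       ∀ w → ∃[ i ] f i ≡ w
injective⇒surjective {suc n} refl f f-inj w with any? (λ i → f i ≟ w)
... | yes found = found
... | no ∄ = contradiction
  (injective⇒≤ {f = λ i → punchOut (avoids i)} λ {i} {j} eq →
    f-inj (punchOut-injective (avoids i) (avoids j) eq))
  ℕ.1+n≰n
  where
  avoids : ∀ i → w ≢ f i
  avoids i w≡fi = ∄ (i , sym w≡fi)

private
  module C₅ = Graph C₅

  -- Shows that a 5-cycle through all of `H` accounts for every edge: an edge between vertices two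
  -- steps apart on the cycle would close a triangle.
  C₅-diameter : ∀ u v → u C₅.~ v ⊎ u ≡ v ⊎ ∃[ w ] (u C₅.~ w × w C₅.~ v)
  C₅-diameter = from-yes (all? λ u → all? λ v →
    (u C₅.~? v) ⊎-dec (u ≟ v) ⊎-dec any? λ w → (u C₅.~? w) ×-dec (w C₅.~? v))

module _ {H : Graph m} (triangle-free : TriangleFree H) (m≡5 : m ≡ 5) (α≡2 : α H ≡ 2) where
  open Graph H
  private
    a≡2 : αₛ H full ≡ 2
    a≡2 = trans (sym (α-presented (presents-self H))) α≡2

    deg≤2 : ∀ u → deg H full u ≤ 2
    deg≤2 u = subst (deg H full u ≤_) a≡2 (deg≤αₛ triangle-free full u)

    -- A vertex of smaller degree would make the total weight exceed 5 · 340 = 2 · 850.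
    deg≡2 : ∀ u → deg H full u ≡ 2
    deg≡2 u with ℕ.m≤n⇒m<n∨m≡n (deg≤2 u)
    ... | inj₂ d≡2 = d≡2
    ... | inj₁ d<2
      with T , T⊆ , T-indep , le ← weighted-independent H triangle-free (count full) full ℕ.≤-refl =
      contradiction
        (ℕ.≤-trans le (ℕ.*-monoˡ-≤ 850 (subst (count T ≤_) a≡2
          (αₛ-maximal H full (T , T⊆ , T-indep , refl)))))
        (ℕ.<⇒≱ (subst (_< totalWeight H full) (trans (∑-const m 340) (cong (_* 340) m≡5))
          (∑-mono-< (λ v → at-least (weight-antitone (deg≤2 v))) u
            (at-least (ℕ.≤-trans (from-yes (341 ℕ.≤? 425)) (weight-antitone (s≤s⁻¹ d<2)))))))
      where
      at-least : ∀ {w k} → k ≤ w → k ≤ 1 * w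
      at-least {w} {k} = subst (k ≤_) (sym (ℕ.*-identityˡ w))

    nbr : Fin m → Subsetᵇ m
    nbr v = adj H full v

    nbr⁺ : ∀ {u v} → u ~ v → nbr u v ≡ true
    nbr⁺ = adj⁺ H full refl refl

    nbr⁻ : ∀ {u v} → nbr u v ≡ true → u ~ v
    nbr⁻ = proj₂ ∘ proj₂ ∘ adj⁻ H full

    other-neighbour : ∀ {u v} → u ~ v → ∃[ w ] (u ~ w × w ≢ v)
    other-neighbour {u} {v} u~v with empty⊎member (nbr u ∖ ⁅ v ⁆)
    ... | inj₁ none = contradiction
      (trans (sym (deg≡2 u)) (trans (count-remove {P = nbr u} (nbr⁺ u~v)) (cong suc none))) λ ()
    ... | inj₂ (w , w∈) =
      let uw , w≢v = ∖⁻ {P = nbr u} {⁅ v ⁆} w w∈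
      in w , nbr⁻ uw , λ { refl → w≢v (⁅⁆⁺ w) }

    far : Fin m → Subsetᵇ m
    far v = full ∖ ⁅ v ⁆ ∖ nbr v

    far⁺ : ∀ {v w} → w ≢ v → ¬ v ~ w → far v w ≡ true
    far⁺ {v} {w} w≢v v≁w =
      ∖⁺ {P = full ∖ ⁅ v ⁆} {nbr v} (∖⁺ {P = full} {⁅ v ⁆} {w} refl (w≢v ∘ ⁅⁆⁻)) (v≁w ∘ nbr⁻)

    far⁻ : ∀ {v w} → far v w ≡ true → w ≢ v × ¬ v ~ w
    far⁻ {v} {w} w∈ =
      let w∈′ , v≁w = ∖⁻ {P = full ∖ ⁅ v ⁆} {nbr v} w w∈
          _ , w≢v   = ∖⁻ {P = full} {⁅ v ⁆} w w∈′
      in (λ { refl → w≢v (⁅⁆⁺ w) }) , v≁w ∘ nbr⁺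

    count-far : ∀ v → count (far v) ≡ 2
    count-far v = ℕ.+-cancelˡ-≡ 3 _ _ (begin
      3 + count (far v)                      ≡⟨ cong (λ d → suc (d + count (far v))) (deg≡2 v) ⟨
      suc (count (nbr v) + count (far v))    ≡⟨ cong suc (count-∖ {P = full ∖ ⁅ v ⁆} {nbr v} nbr⊆) ⟨
      suc (count (full ∖ ⁅ v ⁆))             ≡⟨ count-remove {P = full} {v} refl ⟨
      count {m} full                         ≡⟨ count-full ⟩
      m                                      ≡⟨ m≡5 ⟩
      5                                      ∎)
      where
      open ≡-Reasoning
      nbr⊆ : nbr v ⊆ full ∖ ⁅ v ⁆
      nbr⊆ w vw = ∖⁺ {P = full} {⁅ v ⁆} {w} refl λ w∈ → ~⇒≢ {G = H} (nbr⁻ vw) (sym (⁅⁆⁻ w∈))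

    -- Otherwise `v`, `c` and `d` would form an independent set of size 3.
    far-adjacent : ∀ {v c d} → far v c ≡ true → far v d ≡ true → c ≢ d → c ~ d
    far-adjacent {v} {c} {d} c∈ d∈ c≢d with c ~? d
    ... | yes c~d = c~d
    ... | no c≁d = contradiction
      (subst (3 ≤_) a≡2 (αₛ-maximal H full (T , (λ _ _ → refl) , T-indep , T-size)))
      λ { (s≤s (s≤s ())) }
      where
      S = insert c ⁅ d ⁆
      T = insert v S

      S⁻ : ∀ u → S u ≡ true → u ≡ c ⊎ u ≡ d
      S⁻ u u∈ with insert⁻ {v = c} {⁅ d ⁆} u∈
      ... | inj₁ u≡c = inj₁ u≡c
      ... | inj₂ u∈d = inj₂ (⁅⁆⁻ u∈d)

      T-indep : Indep H T
      T-indep = insert-indep {G = H} (insert-indep {G = H}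
          (λ u w u∈ w∈ u~w → ~⇒≢ {G = H} u~w (trans (⁅⁆⁻ u∈) (sym (⁅⁆⁻ w∈))))
          (λ u u∈ c~u → c≁d (subst (c ~_) (⁅⁆⁻ u∈) c~u)))
        λ u u∈ v~u → case S⁻ u u∈ of λ
          { (inj₁ refl) → proj₂ (far⁻ c∈) v~u ; (inj₂ refl) → proj₂ (far⁻ d∈) v~u }

      T-size : count T ≡ 3
      T-size = trans
        (count-insert {v = v} {S} λ v∈ → case S⁻ v v∈ of λ
          { (inj₁ refl) → proj₁ (far⁻ c∈) refl ; (inj₂ refl) → proj₁ (far⁻ d∈) refl })
        (cong suc (trans (count-insert {v = c} {⁅ d ⁆} (c≢d ∘ ⁅⁆⁻)) (cong suc (count-⁅⁆ d))))

    FiveCycle : Set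
    FiveCycle = Σ[ p ∈ Vec (Fin m) 5 ] (Unique p ×
      (∀ i j → toℕ j ≡ suc (toℕ i) % 5 → lookup p i ~ lookup p j))

    -- The two non-neighbours `c` and `d` of `v` are adjacent. Their other neighbours `x` and `y`
    -- cannot be further non-neighbours of `v`, so both are adjacent to `v`; they are distinct, or
    -- `c`, `d`, `x` would be a triangle.
    five-cycle : Fin m → FiveCycle
    five-cycle v with c , d , c∈ , d∈ , c≢d , cover ← two-members {P = far v} (count-far v) =
      v ∷ x ∷ c ∷ d ∷ y ∷ [] ,
      ((~⇒≢ {G = H} v~x ∷ ≢-sym (proj₁ (far⁻ c∈)) ∷ ≢-sym (proj₁ (far⁻ d∈)) ∷ ~⇒≢ {G = H} v~y ∷ [])
      ∷ (~⇒≢ {G = H} (~-sym c~x) ∷ x≢d ∷ x≢y ∷ [])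
      ∷ (c≢d ∷ ≢-sym y≢c ∷ [])
      ∷ (~⇒≢ {G = H} d~y ∷ [])
      ∷ [] ∷ []) ,
      λ { 0F 1F refl → v~x ; 1F 2F refl → ~-sym c~x ; 2F 3F refl → c~d
        ; 3F 4F refl → d~y ; 4F 0F refl → ~-sym v~y }
      where
      c~d = far-adjacent c∈ d∈ c≢d

      x-data = other-neighbour c~d
      y-data = other-neighbour (~-sym c~d)
      x = proj₁ x-data
      y = proj₁ y-data
      c~x = proj₁ (proj₂ x-data)
      d~y = proj₁ (proj₂ y-data)
      x≢d = proj₂ (proj₂ x-data)
      y≢c = proj₂ (proj₂ y-data)

      toward-v : ∀ {u w} → far v u ≡ true → u ~ w → w ≢ c → w ≢ d → v ~ w
      toward-v {u} {w} u∈ u~w w≢c w≢d with v ~? w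
      ... | yes v~w = v~w
      ... | no v≁w = case cover w (far⁺ (λ { refl → proj₂ (far⁻ u∈) (~-sym u~w) }) v≁w) of λ
        { (inj₁ w≡c) → contradiction w≡c w≢c ; (inj₂ w≡d) → contradiction w≡d w≢d }

      v~x = toward-v c∈ c~x (≢-sym (~⇒≢ {G = H} c~x)) x≢d
      v~y = toward-v d∈ d~y y≢c (≢-sym (~⇒≢ {G = H} d~y))

      x≢y : x ≢ y
      x≢y x≡y = triangle-free c~d (subst (d ~_) (sym x≡y) d~y) (~-sym c~x)

    cycle⇒≅C₅ : FiveCycle → H ≅ C₅
    cycle⇒≅C₅ (p , p-unique , step) =
      mk↔ₛ′ to from (λ i → from-injective (from-to (from i))) from-to ,
      λ u v → mk⇔ (adj-to u v) λ uv → subst₂ _~_ (from-to u) (from-to v) (adj-from (to u) (to v) uv)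
      where
      from : Fin 5 → Fin m
      from = lookup p

      from-injective : ∀ {i j} → from i ≡ from j → i ≡ j
      from-injective = lookup-injective p-unique _ _

      onto : ∀ w → ∃[ i ] from i ≡ w
      onto = injective⇒surjective (sym m≡5) from from-injective

      to : Fin m → Fin 5
      to = proj₁ ∘ onto

      from-to : ∀ w → from (to w) ≡ w
      from-to = proj₂ ∘ onto

      adj-from : ∀ i j → i C₅.~ j → from i ~ from j
      adj-from i j (inj₁ eq) = step i j eq
      adj-from i j (inj₂ eq) = ~-sym (step j i eq)

      adj-to : ∀ u v → u ~ v → to u C₅.~ to v
      adj-to u v u~v with C₅-diameter (to u) (to v)
      ... | inj₁ uv = uv
      ... | inj₂ (inj₁ eq) = contradiction
        (trans (sym (from-to u)) (trans (cong from eq) (from-to v))) (~⇒≢ {G = H} u~v)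
      ... | inj₂ (inj₂ (w , uw , wv)) = contradiction u~v λ u~v → triangle-free
        (subst (_~ from w) (from-to u) (adj-from (to u) w uw))
        (subst (from w ~_) (from-to v) (adj-from w (to v) wv)) (~-sym u~v)

  ≅C₅ : H ≅ C₅
  ≅C₅ = cycle⇒≅C₅ (five-cycle (subst Fin (sym m≡5) zero))

module _ {H : Graph m} (iso : H ≅ C₅) where
  private
    f = proj₁ iso

    presents-C₅ : Presents H C₅ full
    presents-C₅ = record
      { embed     = Inverse.to f
      ; injective = λ {i} {j} eq → trans (sym (Inverse.strictlyInverseʳ f i))
          (trans (cong (Inverse.from f) eq) (Inverse.strictlyInverseʳ f j))
      ; ∈P        = λ _ → refl
      ; onto      = λ v _ → Inverse.from f v , Inverse.strictlyInverseˡ f v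
      ; adj⁺      = Equivalence.to (proj₂ iso _ _)
      ; adj⁻      = Equivalence.from (proj₂ iso _ _)
      ; ∑-embed   = λ g → trans (sym (∑-permute g f)) (∑-cong λ v → sym (ℕ.*-identityˡ (g v)))
      }

  -- The isomorphism reduces this to `α C₅`, which evaluates to 2 by running its search.
  ≅C₅⇒α≡2 : α H ≡ 2
  ≅C₅⇒α≡2 = trans (α-presented presents-C₅) (sym (α-presented (presents-self C₅)))

-- From rational numbers to doubled natural numbers.

private
  -- `mkℚᵘ` stores the denominator minus one, so the right side is (2x + 3y) / 2. Without
  -- normalisation, comparisons become cross-multiplications.
  value-ℚ : ∀ x y → ℚ.toℚᵘ (fromℕ x ℚ.+ (ℤ.+ 3 ℚ./ 2) ℚ.* fromℕ y) ≃ᵘ mkℚᵘ (ℤ.+ (x * 2 + y * 3)) 1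
  value-ℚ x y = begin
    ℚ.toℚᵘ (fromℕ x ℚ.+ (ℤ.+ 3 ℚ./ 2) ℚ.* fromℕ y)
      ≈⟨ ℚ.toℚᵘ-homo-+ (fromℕ x) _ ⟩
    ℚ.toℚᵘ (fromℕ x) ℚᵘ.+ ℚ.toℚᵘ ((ℤ.+ 3 ℚ./ 2) ℚ.* fromℕ y)
      ≈⟨ ℚᵘ.+-cong (ℚ.toℚᵘ-fromℚᵘ (mkℚᵘ (ℤ.+ x) 0)) (ℚᵘ.≃-trans (ℚ.toℚᵘ-homo-* (ℤ.+ 3 ℚ./ 2) (fromℕ y))
           (ℚᵘ.*-congˡ {mkℚᵘ (ℤ.+ 3) 1} (ℚ.toℚᵘ-fromℚᵘ (mkℚᵘ (ℤ.+ y) 0)))) ⟩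
    mkℚᵘ (ℤ.+ x) 0 ℚᵘ.+ mkℚᵘ (ℤ.+ 3) 1 ℚᵘ.* mkℚᵘ (ℤ.+ y) 0
      ≈⟨ ℚᵘ.*≡* (cong (ℤ._* ℤ.+ 2) numerator) ⟩
    mkℚᵘ (ℤ.+ (x * 2 + y * 3)) 1 ∎
    where
    open ℚᵘ.≃-Reasoning
    numerator : ℤ.+ x ℤ.* ℤ.+ 2 ℤ.+ ℤ.+ 3 ℤ.* ℤ.+ y ℤ.* ℤ.+ 1 ≡ ℤ.+ (x * 2 + y * 3)
    numerator = trans
      (cong₂ ℤ._+_ (sym (ℤ.pos-* x 2)) (trans (ℤ.*-identityʳ _)
        (trans (sym (ℤ.pos-* 3 y)) (cong ℤ.+_ (ℕ.*-comm 3 y)))))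
      (sym (ℤ.pos-+ (x * 2) (y * 3)))

  order-ℚ : ∀ k → ℚ.toℚᵘ (fromℕ k) ≃ᵘ mkℚᵘ (ℤ.+ k) 0
  order-ℚ k = ℚ.toℚᵘ-fromℚᵘ (mkℚᵘ (ℤ.+ k) 0)

  ≥-ℚ : ∀ x y k → k * 2 ≤ x * 2 + y * 3 →
        fromℕ x ℚ.+ (ℤ.+ 3 ℚ./ 2) ℚ.* fromℕ y ℚ.≥ fromℕ k
  ≥-ℚ x y k le = ℚ.toℚᵘ-cancel-≤ (ℚᵘ.≤-respˡ-≃ (ℚᵘ.≃-sym (order-ℚ k))
    (ℚᵘ.≤-respʳ-≃ (ℚᵘ.≃-sym (value-ℚ x y)) (ℚᵘ.*≤* (subst₂ ℤ._≤_
      (ℤ.pos-* k 2) (sym (ℤ.*-identityʳ _)) (ℤ.+≤+ le)))))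

  ≡-ℚ : ∀ x y k → fromℕ x ℚ.+ (ℤ.+ 3 ℚ./ 2) ℚ.* fromℕ y ≡ fromℕ k ⇔ x * 2 + y * 3 ≡ k * 2
  ≡-ℚ x y k = mk⇔
    (λ eq → ℤ.+-injective (to-ℕ (ℚᵘ.≃-trans (ℚᵘ.≃-sym (value-ℚ x y))
      (ℚᵘ.≃-trans (ℚ.toℚᵘ-cong eq) (order-ℚ k)))))
    (λ eq → ℚ.toℚᵘ-injective (ℚᵘ.≃-trans (value-ℚ x y) (ℚᵘ.≃-trans
      (ℚᵘ.*≡* (trans (ℤ.*-identityʳ _) (trans (cong ℤ.+_ eq) (ℤ.pos-* k 2))))
      (ℚᵘ.≃-sym (order-ℚ k)))))
    where
    to-ℕ : mkℚᵘ (ℤ.+ (x * 2 + y * 3)) 1 ≃ᵘ mkℚᵘ (ℤ.+ k) 0 → ℤ.+ (x * 2 + y * 3) ≡ ℤ.+ (k * 2)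
    to-ℕ (ℚᵘ.*≡* eq) = trans (sym (ℤ.*-identityʳ _)) (trans eq (sym (ℤ.pos-* k 2)))

-- Both directions of the equality statement.

module _ (G : Graph n) (triangle-free : TriangleFree G) (Δ≤4 : Δ G ≤ 4) where
  open Graph G
  private
    deg≤4 : ∀ P u → deg G P u ≤ 4
    deg≤4 P u = ℕ.≤-trans (deg≤Δ G P u) Δ≤4

    Good : ∀ {k} → Graph k → Set
    Good H = order H ≡ 1 ⊎ H ≅ C₅ ⊎ (order H ≡ 13 × α H ≡ 4 × β H ≡ 6)

    value≡ : value G full ≡ α G * 2 + β G * 3
    value≡ = sym (cong₂ (λ x y → x * 2 + y * 3)
      (α-presented (presents-self G)) (β-presented (presents-self G)))

    order-full≡ : count {n} full * 2 ≡ n * 2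
    order-full≡ = cong (_* 2) count-full

  bound : n * 2 ≤ α G * 2 + β G * 3
  bound = subst₂ _≤_ order-full≡ value≡ (order≤value triangle-free deg≤4 full)

  exceptional⇒good : ∀ C → Exceptional (count (lookup C)) (αₛ G (lookup C)) →
    count (lookup C) ≡ suc (βₛ G (lookup C) * 2) → Good (G [ C ])
  exceptional⇒good C exceptional size≡ = by-cases exceptional
    where
    presents : Presents (G [ C ]) G (lookup C)
    presents = presents-induced G C λ _ → refl

    by-cases : Exceptional (count (lookup C)) (αₛ G (lookup C)) → Good (G [ C ])
    by-cases (inj₁ (≡1 , _)) = inj₁ (trans ∣ C ∣≡count ≡1)
    by-cases (inj₂ (inj₁ (≡5 , a≡2))) = inj₂ (inj₁ (≅C₅ {H = G [ C ]} triangle-free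
      (trans ∣ C ∣≡count ≡5) (trans (α-presented presents) a≡2)))
    by-cases (inj₂ (inj₂ (≡13 , a≡4))) = inj₂ (inj₂
      ( trans ∣ C ∣≡count ≡13
      , trans (α-presented presents) a≡4
      -- Here `size≡` reads 13 = 1 + 2β.
      , trans (β-presented presents)
          (ℕ.*-cancelʳ-≡ _ 6 2 (ℕ.suc-injective (trans (sym size≡) ≡13))) ))

  tight⇒good : α G * 2 + β G * 3 ≡ n * 2 → ∀ C → IsComponent G C → Good (G [ C ])
  tight⇒good tight C (v , C-reach) = exceptional⇒good C
    (component-exceptional triangle-free deg≤4 comp C-tight)
    (component-order triangle-free deg≤4 comp C-tight)
    where
    comp : Component G v (lookup C)
    comp w = mk⇔ (λ w∈ → Equivalence.to (C-reach w) (lookup⇒[]= w C w∈))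
      (λ path → []=⇒lookup (Equivalence.from (C-reach w) path))

    C-tight : count (lookup C) * 2 ≡ value G (lookup C)
    C-tight = component-tight triangle-free deg≤4 comp
      (ℕ.≤-reflexive (trans value≡ (trans tight (sym order-full≡))))

  -- For one vertex and for `C₅`, β is estimated by half the order, rounded down.
  good⇒value≤ : ∀ Q → Good (G [ tabulate Q ]) → value G Q ≤ count Q * 2
  good⇒value≤ Q good = by-cases good
    where
    presents : Presents (G [ tabulate Q ]) G Q
    presents = presents-induced G (tabulate Q) (lookup∘tabulate Q)

    numbers : ∀ {N} x y → count Q ≡ N → αₛ G Q ≤ x → βₛ G Q ≤ y → x * 2 + y * 3 ≤ N * 2 →
              value G Q ≤ count Q * 2
    numbers x y refl a≤ b≤ le =
      ℕ.≤-trans (ℕ.+-mono-≤ (ℕ.*-monoˡ-≤ 2 a≤) (ℕ.*-monoˡ-≤ 3 b≤)) le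

    b≤half : ∀ {N} k → count Q ≡ N → N < suc k * 2 → βₛ G Q ≤ k
    b≤half k refl N< = s≤s⁻¹ (ℕ.*-cancelʳ-< 2 _ (suc k) (ℕ.≤-<-trans (2βₛ≤order G Q) N<))

    by-cases : Good (G [ tabulate Q ]) → value G Q ≤ count Q * 2
    by-cases (inj₁ ≡1) = numbers 1 0 order≡ (subst (αₛ G Q ≤_) order≡ (αₛ≤order G Q))
      (b≤half 0 order≡ (from-yes (1 ℕ.<? 2))) ℕ.≤-refl
      where order≡ = trans (sym (∣tabulate∣ Q)) ≡1
    by-cases (inj₂ (inj₁ iso)) = numbers 2 2 order≡
      (ℕ.≤-reflexive (trans (sym (α-presented presents)) (≅C₅⇒α≡2 iso)))
      (b≤half 2 order≡ (from-yes (5 ℕ.<? 6))) ℕ.≤-refl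
      where order≡ = trans (sym (∣tabulate∣ Q)) (↔⇒≡ (proj₁ iso))
    by-cases (inj₂ (inj₂ (≡13 , α≡4 , β≡6))) = numbers 4 6 (trans (sym (∣tabulate∣ Q)) ≡13)
      (ℕ.≤-reflexive (trans (sym (α-presented presents)) α≡4))
      (ℕ.≤-reflexive (trans (sym (β-presented presents)) β≡6)) ℕ.≤-refl

  good⇒tight : (∀ C → IsComponent G C → Good (G [ C ])) → α G * 2 + β G * 3 ≡ n * 2
  good⇒tight good = ℕ.≤-antisym
    (subst₂ _≤_ value≡ order-full≡ (good-components triangle-free deg≤4
      (λ {v} {Q} comp → good⇒value≤ Q (good (tabulate Q) (v , λ w → mk⇔
        (λ w∈ → Equivalence.to (comp w) (trans (sym (lookup∘tabulate Q w)) ([]=⇒lookup w∈)))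
        (λ path → lookup⇒[]= w _ (trans (lookup∘tabulate Q w) (Equivalence.from (comp w) path))))))
      (count {n} full) full (λ _ _ _ → refl) ℕ.≤-refl))
    bound

open import Data.Integer.Base using (+_)
open import Data.Rational.Base as ℚ using (_/_)

theorem2 : ∀ n (G : Graph n) → TriangleFree G → Δ G ≤ 4 →
    (fromℕ (α G) ℚ.+ (+ 3 / 2) ℚ.* fromℕ (β G) ℚ.≥ fromℕ (order G))
    × (fromℕ (α G) ℚ.+ (+ 3 / 2) ℚ.* fromℕ (β G) ≡ fromℕ (order G)
    ⇔ (∀ C → IsComponent G C →
    order (G [ C ]) ≡ 1
    ⊎ G [ C ] ≅ C₅
    ⊎ (order (G [ C ]) ≡ 13 × α (G [ C ]) ≡ 4 × β (G [ C ]) ≡ 6)))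
theorem2 n G triangle-free Δ≤4 =
  ≥-ℚ (α G) (β G) n (bound G triangle-free Δ≤4) ,
  mk⇔
    (tight⇒good G triangle-free Δ≤4 ∘ Equivalence.to (≡-ℚ (α G) (β G) n))
    (Equivalence.from (≡-ℚ (α G) (β G) n) ∘ good⇒tight G triangle-free Δ≤4)
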